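{- Let $k\ge 2$ and let $G$ be a connected $k$-uniform hypergraph on the vertex set $[n]=\{1,\dots,n\}$ with at least one edge, with adjacency tensor $\mathbb{A}$ and degree diagonal tensor $\mathbb{D}$, and let $\mathbb{Q}=\mathbb{D}+\mathbb{A}$ be the signless Laplacian tensor of $G$. Then the following two conditions are equivalent: (1) $k$ is even and $G$ is odd-bipartite. (2) $0$ is an H-eigenvalue of $\mathbb{Q}$.
   Context: A $k$-uniform hypergraph $G=(V,E)$ has a finite nonempty vertex set $V$ and a set $E$ of edges, each edge being a $k$-element subset of $V$. $G$ is connected if any two vertices can be joined by a sequence of edges in which consecutive edges intersect (the first containing one vertex, the last containing the other); a one-vertex hypergraph is connected. An order $k$ dimension $n$ tensor is an array $\mathbb{T}=(t_{i_1\cdots i_k})$ with $i_1,\dots,i_k\in[n]$. The adjacency tensor $\mathbb{A}$ of $G$ (with $V=[n]$) is the order $k$ dimension $n$ tensor with $a_{i_1\cdots i_k}=\frac{1}{(k-1)!}$ if $\{i_1,\dots,i_k\}\in E$ (so the $i_j$ are distinct) and $0$ otherwise. The degree diagonal tensor $\mathbb{D}$ is the order $k$ dimension $n$ tensor with $d_{i\cdots i}$ equal to the degree of $i$ (the number of edges containing $i$) and all other entries $0$. For a vector $x$ of dimension $n$, $\mathbb{T}x$ is given by $(\mathbb{T}x)_i=\sum_{i_2,\dots,i_k=1}^n t_{ii_2\cdots i_k}x_{i_2}\cdots x_{i_k}$, and $x^{[k-1]}=(x_1^{k-1},\dots,x_n^{k-1})^T$. A number $\lambda$ is an H-eigenvalue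 of the real tensor $\mathbb{T}$ if $\mathbb{T}x=\lambda x^{[k-1]}$ for some nonzero real vector $x\in\mathbb{R}^n$. A $k$-uniform hypergraph $G=(V,E)$ is odd-bipartite if $k$ is even and there is a proper subset $V_1\subsetneq V$ such that every edge of $G$ contains an odd number of vertices of $V_1$. -}

module Defs where

open import Algebra.Bundles.Raw using (RawSemiring)
open import Data.Bool.Base using (if_then_else_)
import Data.Bool.Properties as Bool
open import Data.Fin.Base using (Fin)
import Data.Fin.Properties as Fin
open import Data.Fin.Subset using (Subset; ⁅_⁆; ⋃; _∩_; _∈_; _⊂_; ⊤; ∣_∣; Nonempty)
open import Data.Fin.Subset.Properties using (_∈?_)
open import Data.Integer.Base using (1ℤ; +_)
open import Data.List.Base using (List; length; filter)
import Data.List.Membership.DecPropositional as DecMembership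
open import Data.List.Relation.Unary.All using (All)
open import Data.List.Relation.Unary.Unique.Propositional using (Unique)
open import Data.Nat.Base as ℕ using (ℕ; zero; suc; _!)
open import Data.Nat.Divisibility using () renaming (_∣_ to _∣ℕ_)
import Data.Nat.Properties as ℕ
open import Data.Product.Base using (_×_; _,_; ∃; ∃-syntax; Σ-syntax)
open import Data.Rational.Base as ℚ using (ℚ; 0ℚ; 1ℚ; ½)
import Data.Rational.Properties as ℚ
open import Data.Rational.Solver using (module +-*-Solver)
open import Data.Vec.Base as Vec using (Vec; []; _∷_)
import Data.Vec.Properties as Vec
import Data.Vec.Relation.Unary.All as VecAll
open import Level using (0ℓ)
open import Relation.Binary.Construct.Closure.ReflexiveTransitive using (Star)
open import Relation.Binary.Definitions using (DecidableEquality)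
open import Relation.Binary.PropositionalEquality
open import Relation.Nullary.Decidable using (⌊_⌋)
open import Relation.Nullary.Negation.Core using (¬_)

-- ℝ is the setoid of Cauchy sequences of rationals modulo null sequences, with
-- pointwise operations; `_≈_` is its equality.

IsCauchy : (ℕ → ℚ) → Set
IsCauchy s = ∀ ε → 0ℚ ℚ.< ε →
  ∃[ N ] ∀ m n → N ℕ.≤ m → N ℕ.≤ n → ℚ.∣ s m ℚ.- s n ∣ ℚ.< ε

record ℝ : Set where
  constructor mkℝ
  field
    seq    : ℕ → ℚ
    cauchy : IsCauchy seq

open ℝ public

infix 4 _≈_
_≈_ : ℝ → ℝ → Set
x ≈ y = ∀ ε → 0ℚ ℚ.< ε → ∃[ N ] ∀ n → N ℕ.≤ n → ℚ.∣ seq x n ℚ.- seq y n ∣ ℚ.< ε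

-- Abstract because `_≈_` depends only on `seq`: the moduli never need to compute.
abstract

  0<½* : ∀ {ε} → 0ℚ ℚ.< ε → 0ℚ ℚ.< ½ ℚ.* ε
  0<½* {ε} 0<ε = ℚ.positive⁻¹ (½ ℚ.* ε) {{ℚ.pos*pos⇒pos ½ ε {{ℚ.positive 0<ε}}}}

  ½+½ : ∀ ε → ½ ℚ.* ε ℚ.+ ½ ℚ.* ε ≡ ε
  ½+½ ε = trans (sym (ℚ.*-distribʳ-+ ε ½ ½)) (ℚ.*-identityˡ ε)

  const-cauchy : ∀ q → IsCauchy (λ _ → q)
  const-cauchy q ε 0<ε = 0 , λ _ _ _ _ →
    subst (ℚ._< ε) (sym (cong ℚ.∣_∣ (ℚ.+-inverseʳ q))) 0<ε

  +-cauchy : ∀ s t → IsCauchy s → IsCauchy t → IsCauchy (λ n → s n ℚ.+ t n)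
  +-cauchy s t cs ct ε 0<ε
    with cs (½ ℚ.* ε) (0<½* 0<ε) | ct (½ ℚ.* ε) (0<½* 0<ε)
  ... | M , hs | N , ht = M ℕ.⊔ N , λ m n p q → begin-strict
    ℚ.∣ (s m ℚ.+ t m) ℚ.- (s n ℚ.+ t n) ∣          ≡⟨ cong ℚ.∣_∣ (regroup (s m) (t m) (s n) (t n)) ⟩
    ℚ.∣ (s m ℚ.- s n) ℚ.+ (t m ℚ.- t n) ∣          ≤⟨ ℚ.∣p+q∣≤∣p∣+∣q∣ (s m ℚ.- s n) (t m ℚ.- t n) ⟩
    ℚ.∣ s m ℚ.- s n ∣ ℚ.+ ℚ.∣ t m ℚ.- t n ∣        <⟨ ℚ.+-mono-<
      (hs m n (ℕ.≤-trans (ℕ.m≤m⊔n M N) p) (ℕ.≤-trans (ℕ.m≤m⊔n M N) q))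
      (ht m n (ℕ.≤-trans (ℕ.m≤n⊔m M N) p) (ℕ.≤-trans (ℕ.m≤n⊔m M N) q)) ⟩
    ½ ℚ.* ε ℚ.+ ½ ℚ.* ε                            ≡⟨ ½+½ ε ⟩
    ε                                              ∎
    where
    open ℚ.≤-Reasoning
    open +-*-Solver
    regroup : ∀ a b c d → (a ℚ.+ b) ℚ.- (c ℚ.+ d) ≡ (a ℚ.- c) ℚ.+ (b ℚ.- d)
    regroup = solve 4 (λ a b c d → (a :+ b) :- (c :+ d) := (a :- c) :+ (b :- d)) refl

  eventually-bounded : ∀ {s} → IsCauchy s →
    ∃[ B ] 0ℚ ℚ.< B × (∃[ N ] ∀ n → N ℕ.≤ n → ℚ.∣ s n ∣ ℚ.< B)
  eventually-bounded {s} cs with cs 1ℚ (ℚ.positive⁻¹ 1ℚ)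
  ... | N , h = 1ℚ ℚ.+ ℚ.∣ s N ∣ ,
    ℚ.+-mono-<-≤ (ℚ.positive⁻¹ 1ℚ) (ℚ.0≤∣p∣ (s N)) , N , λ n N≤n → begin-strict
      ℚ.∣ s n ∣                            ≡⟨ cong ℚ.∣_∣ (split (s n) (s N)) ⟩
      ℚ.∣ (s n ℚ.- s N) ℚ.+ s N ∣          ≤⟨ ℚ.∣p+q∣≤∣p∣+∣q∣ (s n ℚ.- s N) (s N) ⟩
      ℚ.∣ s n ℚ.- s N ∣ ℚ.+ ℚ.∣ s N ∣      <⟨ ℚ.+-monoˡ-< ℚ.∣ s N ∣ (h n N N≤n ℕ.≤-refl) ⟩
      1ℚ ℚ.+ ℚ.∣ s N ∣                     ∎
    where
    open ℚ.≤-Reasoning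
    open +-*-Solver
    split : ∀ a b → a ≡ (a ℚ.- b) ℚ.+ b
    split = solve 2 (λ a b → a := (a :- b) :+ b) refl

  divide : ∀ B ε → 0ℚ ℚ.< B → 0ℚ ℚ.< ε → ∃[ δ ] 0ℚ ℚ.< δ × B ℚ.* δ ≡ ε
  divide B ε 0<B 0<ε = 1/B ℚ.* ε
    , ℚ.positive⁻¹ (1/B ℚ.* ε) {{ℚ.pos*pos⇒pos 1/B {{ℚ.1/pos⇒pos B}} ε}}
    , trans (sym (ℚ.*-assoc B 1/B ε))
        (trans (cong (ℚ._* ε) (ℚ.*-inverseʳ B)) (ℚ.*-identityˡ ε))
    where
    instance
      B-pos : ℚ.Positive B
      B-pos = ℚ.positive 0<B
      ε-pos : ℚ.Positive ε
      ε-pos = ℚ.positive 0<ε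
      B-nonZero : ℚ.NonZero B
      B-nonZero = ℚ.pos⇒nonZero B
    1/B : ℚ
    1/B = ℚ.1/ B

  *-small : ∀ {B δ} a b → 0ℚ ℚ.< B → ℚ.∣ a ∣ ℚ.< B → ℚ.∣ b ∣ ℚ.< δ →
            ℚ.∣ a ℚ.* b ∣ ℚ.< B ℚ.* δ
  *-small {B} {δ} a b 0<B a<B b<δ = begin-strict
    ℚ.∣ a ℚ.* b ∣          ≡⟨ ℚ.∣p*q∣≡∣p∣*∣q∣ a b ⟩
    ℚ.∣ a ∣ ℚ.* ℚ.∣ b ∣    ≤⟨ ℚ.*-monoʳ-≤-nonNeg ℚ.∣ b ∣ {{ℚ.∣-∣-nonNeg b}} (ℚ.<⇒≤ a<B) ⟩
    B ℚ.* ℚ.∣ b ∣          <⟨ ℚ.*-monoʳ-<-pos B {{ℚ.positive 0<B}} b<δ ⟩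
    B ℚ.* δ                ∎
    where open ℚ.≤-Reasoning

  diff-* : ∀ a b c d → a ℚ.* b ℚ.- c ℚ.* d ≡ a ℚ.* (b ℚ.- d) ℚ.+ d ℚ.* (a ℚ.- c)
  diff-* = solve 4 (λ a b c d → a :* b :- c :* d := a :* (b :- d) :+ d :* (a :- c)) refl
    where open +-*-Solver

  diff-*-small : ∀ {B C δ η} a b c d → 0ℚ ℚ.< B → 0ℚ ℚ.< C →
    ℚ.∣ a ∣ ℚ.< B → ℚ.∣ d ∣ ℚ.< C → ℚ.∣ b ℚ.- d ∣ ℚ.< δ → ℚ.∣ a ℚ.- c ∣ ℚ.< η →
    ℚ.∣ a ℚ.* b ℚ.- c ℚ.* d ∣ ℚ.< B ℚ.* δ ℚ.+ C ℚ.* η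
  diff-*-small {B} {C} {δ} {η} a b c d 0<B 0<C a<B d<C b-d<δ a-c<η =
    subst (λ z → ℚ.∣ z ∣ ℚ.< B ℚ.* δ ℚ.+ C ℚ.* η) (sym (diff-* a b c d))
      (ℚ.≤-<-trans (ℚ.∣p+q∣≤∣p∣+∣q∣ p q)
        (ℚ.+-mono-< {ℚ.∣ p ∣} {B ℚ.* δ} {ℚ.∣ q ∣} {C ℚ.* η}
          (*-small a (b ℚ.- d) 0<B a<B b-d<δ)
          (*-small d (a ℚ.- c) 0<C d<C a-c<η)))
    where
    p q : ℚ
    p = a ℚ.* (b ℚ.- d)
    q = d ℚ.* (a ℚ.- c)

  *-cauchy : ∀ s t → IsCauchy s → IsCauchy t → IsCauchy (λ n → s n ℚ.* t n)
  *-cauchy s t cs ct ε 0<ε =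
    let B , 0<B , N₁ , bs = eventually-bounded cs
        C , 0<C , N₂ , bt = eventually-bounded ct
        δ , 0<δ , Bδ      = divide B (½ ℚ.* ε) 0<B (0<½* 0<ε)
        η , 0<η , Cη      = divide C (½ ℚ.* ε) 0<C (0<½* 0<ε)
        N₃ , hs           = cs η 0<η
        N₄ , ht           = ct δ 0<δ
    in combine B C δ η N₁ N₂ N₃ N₄ 0<B 0<C
         (trans (cong₂ ℚ._+_ Bδ Cη) (½+½ ε)) bs bt hs ht
    where
    combine : ∀ B C δ η N₁ N₂ N₃ N₄ → 0ℚ ℚ.< B → 0ℚ ℚ.< C →
      B ℚ.* δ ℚ.+ C ℚ.* η ≡ ε →
      (∀ n → N₁ ℕ.≤ n → ℚ.∣ s n ∣ ℚ.< B) →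
      (∀ n → N₂ ℕ.≤ n → ℚ.∣ t n ∣ ℚ.< C) →
      (∀ m n → N₃ ℕ.≤ m → N₃ ℕ.≤ n → ℚ.∣ s m ℚ.- s n ∣ ℚ.< η) →
      (∀ m n → N₄ ℕ.≤ m → N₄ ℕ.≤ n → ℚ.∣ t m ℚ.- t n ∣ ℚ.< δ) →
      ∃[ N ] ∀ m n → N ℕ.≤ m → N ℕ.≤ n → ℚ.∣ s m ℚ.* t m ℚ.- s n ℚ.* t n ∣ ℚ.< ε
    combine B C δ η N₁ N₂ N₃ N₄ 0<B 0<C Bδ+Cη≡ε bs bt hs ht =
      (N₁ ℕ.⊔ N₂) ℕ.⊔ (N₃ ℕ.⊔ N₄) , λ m n p q →
      let p₁₂ = ℕ.m⊔n≤o⇒m≤o (N₁ ℕ.⊔ N₂) (N₃ ℕ.⊔ N₄) p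
          p₃₄ = ℕ.m⊔n≤o⇒n≤o (N₁ ℕ.⊔ N₂) (N₃ ℕ.⊔ N₄) p
          q₁₂ = ℕ.m⊔n≤o⇒m≤o (N₁ ℕ.⊔ N₂) (N₃ ℕ.⊔ N₄) q
          q₃₄ = ℕ.m⊔n≤o⇒n≤o (N₁ ℕ.⊔ N₂) (N₃ ℕ.⊔ N₄) q
      in subst (ℚ.∣ s m ℚ.* t m ℚ.- s n ℚ.* t n ∣ ℚ.<_) Bδ+Cη≡ε
           (diff-*-small {B} {C} {δ} {η} (s m) (t m) (s n) (t n) 0<B 0<C
             (bs m (ℕ.m⊔n≤o⇒m≤o N₁ N₂ p₁₂)) (bt n (ℕ.m⊔n≤o⇒n≤o N₁ N₂ q₁₂))
             (ht m n (ℕ.m⊔n≤o⇒n≤o N₃ N₄ p₃₄) (ℕ.m⊔n≤o⇒n≤o N₃ N₄ q₃₄))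
             (hs m n (ℕ.m⊔n≤o⇒m≤o N₃ N₄ p₃₄) (ℕ.m⊔n≤o⇒m≤o N₃ N₄ q₃₄)))

fromℚ : ℚ → ℝ
fromℚ q = mkℝ (λ _ → q) (const-cauchy q)

0ℝ 1ℝ : ℝ
0ℝ = fromℚ 0ℚ
1ℝ = fromℚ 1ℚ

ℝ-rawSemiring : RawSemiring 0ℓ 0ℓ
ℝ-rawSemiring = record
  { Carrier = ℝ
  ; _≈_     = _≈_
  ; _+_     = λ x y → mkℝ (λ n → seq x n ℚ.+ seq y n) (+-cauchy (seq x) (seq y) (cauchy x) (cauchy y))
  ; _*_     = λ x y → mkℝ (λ n → seq x n ℚ.* seq y n) (*-cauchy (seq x) (seq y) (cauchy x) (cauchy y))
  ; 0#      = 0ℝ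
  ; 1#      = 1ℝ
  }

open RawSemiring ℝ-rawSemiring public using (_+_; _*_)
open import Algebra.Definitions.RawSemiring ℝ-rawSemiring public
  using (sum; product; _^_)

Tensor : ℕ → ℕ → Set
Tensor k n = Vec (Fin n) k → ℝ

_⊕_ : ∀ {k n} → Tensor k n → Tensor k n → Tensor k n
(S ⊕ T) is = S is + T is

sumTuples : ∀ {n} r → (Vec (Fin n) r → ℝ) → ℝ
sumTuples zero    f = f []
sumTuples (suc r) f = sum λ i → sumTuples r λ is → f (i ∷ is)

apply : ∀ {r n} → Tensor (suc r) n → (Fin n → ℝ) → (Fin n → ℝ)
apply {r} T x i = sumTuples r λ is → T (i ∷ is) * product λ j → x (Vec.lookup is j)

IsHEigenvalue : ∀ {r n} → Tensor (suc r) n → ℝ → Set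
IsHEigenvalue {r} {n} T μ =
  Σ[ x ∈ (Fin n → ℝ) ] ¬ (∀ i → x i ≈ 0ℝ) × (∀ i → apply T x i ≈ μ * x i ^ r)

-- A finite set of edges is encoded as a duplicate-free list; the order is never
-- used.
record Hypergraph (k n : ℕ) : Set where
  field
    vertices-nonempty : ℕ.NonZero n
    edges             : List (Subset n)
    uniform           : All (λ e → ∣ e ∣ ≡ k) edges
    unique            : Unique edges

_≟ˢ_ : ∀ {n} → DecidableEquality (Subset n)
_≟ˢ_ = Vec.≡-dec Bool._≟_

open module EdgeMembership {n} = DecMembership (_≟ˢ_ {n}) public
  using () renaming (_∈_ to _∈ₗ_; _∈?_ to _∈ₗ?_)

module _ {k n : ℕ} (G : Hypergraph k n) where
  open Hypergraph G

  Edge : Set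
  Edge = ∃ λ e → e ∈ₗ edges

  Meets : Edge → Edge → Set
  Meets (e , _) (f , _) = Nonempty (e ∩ f)

  -- Distinctness of the two vertices makes a one-vertex hypergraph connected.
  Connected : Set
  Connected = ∀ u v → u ≢ v →
    Σ[ (e , e∈E) ∈ Edge ] Σ[ (f , f∈E) ∈ Edge ]
      u ∈ e × v ∈ f × Star Meets (e , e∈E) (f , f∈E)

  OddBipartite : Set
  OddBipartite = 2 ∣ℕ k ×
    Σ[ V₁ ∈ Subset n ] V₁ ⊂ ⊤ × (∀ e → e ∈ₗ edges → ¬ 2 ∣ℕ ∣ e ∩ V₁ ∣)

  degree : Fin n → ℕ
  degree i = length (filter (i ∈?_) edges)

setOf : ∀ {n k} → Vec (Fin n) k → Subset n
setOf is = ⋃ (Vec.toList (Vec.map ⁅_⁆ is))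

module _ {r n : ℕ} (G : Hypergraph (suc r) n) where
  open Hypergraph G

  -- If {i₁ , … , iₖ} is an edge it has k elements, so the iⱼ are then distinct.
  adjacency : Tensor (suc r) n
  adjacency is =
    if ⌊ setOf is ∈ₗ? edges ⌋ then fromℚ ((1ℤ ℚ./ (r !)) {{r ℕ.!≢0}}) else 0ℝ

  degreeDiagonal : Tensor (suc r) n
  degreeDiagonal (i ∷ is) =
    if ⌊ VecAll.all? (i Fin.≟_) is ⌋ then fromℚ (+ degree G i ℚ./ 1) else 0ℝ

  signlessLaplacian : Tensor (suc r) n
  signlessLaplacian = degreeDiagonal ⊕ adjacency

{-# OPTIONS --safe #-}
module Submission where

-- Everything happens over ℚ: the N-th terms of a vector of reals form a rational
-- vector, and (Qx)ᵢ is taken termwise.  Exactly r! tuples (i₂ , … , iₖ) complete i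
-- to a given edge, where r = k − 1, so, writing s for the sign of xᵢʳ,
-- s (Qx)ᵢ + dᵢ (1 − |xᵢ|ʳ) is the weighted sum of 1 + s xᵢ₂⋯xᵢₖ over the tuples that
-- complete i to an edge.  If |x| ≤ 1 all these terms are nonnegative; hence if |Qx| ≤ η
-- and |xᵢ| is within O(η) of 1, each of them is O(η), and so is 1 − |xⱼ| for every
-- neighbour j of i.  Walking from a coordinate with |xᵢ| = 1 covers the connected
-- hypergraph, with constants independent of x.  For η small enough 1 + s xᵢ₂⋯xᵢₖ < 1,
-- i.e. s xᵢ₂⋯xᵢₖ < 0, on every edge: a parity condition on V₁ = { j | xⱼ < 0 } which
-- forces k to be even and every edge to meet V₁ in an odd number of vertices.
-- Being odd-bipartite is decidable, so if G is not odd-bipartite no approximate kernel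
-- vector exists, and every x with Qx ≈ 0 is ≈ 0; this makes the argument constructive.
-- Conversely the sign vector of V₁ is an exact kernel vector.

open import Defs hiding (_+_; _*_; sum; product; _^_)
import Defs as ℝ using (_*_; sum; product; _^_)
open import Algebra.Bundles using (CommutativeRing)
import Algebra.Properties.CommutativeMonoid.Sum as MonoidSum
import Algebra.Properties.CommutativeSemigroup as CommutativeSemigroup
import Algebra.Properties.CommutativeSemiring.Exp as Exp
import Algebra.Properties.Semiring.Mult as Mult
import Algebra.Properties.Semiring.Sum as SemiringSum
open import Data.Bool.Base using (true; false; if_then_else_)
open import Data.Fin.Base using (Fin; zero; suc)
import Data.Fin.Properties as Fin
open import Data.Fin.Subset using (Subset; inside; outside; ⊥; ⊤; ⁅_⁆; _∈_; _∉_; _⊂_; _∪_; _∩_; Nonempty)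
  renaming (∣_∣ to ∣_∣ˢ; _-_ to _-ˢ_)
open import Data.Fin.Subset.Properties
open import Data.Integer.Base as ℤ using (1ℤ)
import Data.Integer.Properties as ℤ
open import Data.List.Base using (List; []; _∷_; length; filter; allFin)
open import Data.List.Membership.Propositional.Properties using (∈-allFin)
open import Data.List.Relation.Unary.All as All using (All; []; _∷_)
open import Data.List.Relation.Unary.Any using (here; there)
open import Data.List.Relation.Unary.Unique.Propositional using (Unique; []; _∷_)
open import Data.Nat.Base as ℕ using (ℕ; zero; suc; _!)
open import Data.Nat.Divisibility using (_∣_; _∤_; divides; _∣?_; _∣0; ∣m+n∣m⇒∣n; ∣m∣n⇒∣m+n)
import Data.Nat.Properties as ℕ
open import Data.Product.Base using (_×_; _,_; ∃; proj₁; proj₂)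
open import Data.Rational.Base
  using (ℚ; 0ℚ; 1ℚ; ½; _+_; _*_; _-_; -_; _≤_; _<_; ∣_∣; nonNegative; positive; _/_; toℚᵘ)
import Data.Rational.Properties as ℚ
open import Data.Rational.Solver using (module +-*-Solver)
import Data.Rational.Unnormalised.Base as ℚᵘ
import Data.Rational.Unnormalised.Properties as ℚᵘ
open import Data.Sum.Base using (_⊎_; inj₁; inj₂)
open import Data.Vec.Base as Vec using (Vec; []; _∷_; lookup; here; there)
import Data.Vec.Properties as Vec
import Data.Vec.Relation.Unary.All as VecAll
open import Function.Bundles using (_⇔_; mk⇔)
open import Relation.Binary.Bundles using (module DecTotalOrder)
open import Relation.Binary.Construct.Closure.ReflexiveTransitive using (Star; ε; _◅_)
open import Relation.Binary.PropositionalEquality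
open import Relation.Nullary using (¬_; Dec; yes; no; contradiction; ⌊_⌋)
open import Relation.Nullary.Decidable using (map′; _×-dec_; ¬?; decidable-stable; from-yes)

open import Data.List.Extrema (DecTotalOrder.totalOrder ℚ.≤-decTotalOrder) using (argmax; f[xs]≤f[argmax])

module ℚR = CommutativeRing ℚ.+-*-commutativeRing
open CommutativeSemigroup ℚR.*-commutativeSemigroup using (x∙yz≈y∙xz)
open Exp ℚR.commutativeSemiring using (_^_; ^-distrib-*; ^-homo-*; ^-assocʳ)
open MonoidSum ℚR.*-commutativeMonoid using () renaming (sum to product; ∑-distrib-+ to ∏-distrib-*)
open Mult ℚR.semiring using (×1-homo-*) renaming (_×_ to _×ℚ_)
open SemiringSum ℚR.semiring using (sum; sum-cong-≗; ∑-distrib-+; *-distribˡ-sum; *-distribʳ-sum; sum-replicate-zero)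
open +-*-Solver using (solve; _:=_; _:+_; _:*_; _:-_; :-_; con)

-- Tuples enumerating a subset

∣p∣≡0⇒p≡⊥ : ∀ {n} {p : Subset n} → ∣ p ∣ˢ ≡ 0 → p ≡ ⊥
∣p∣≡0⇒p≡⊥ {p = p} ∣p∣≡0 = Empty-unique λ (x , x∈p) →
  ℕ.n≮0 (subst (∣ p -ˢ x ∣ˢ ℕ.<_) ∣p∣≡0 (x∈p⇒∣p-x∣<∣p∣ x∈p))

∣p∣≡suc⇒Nonempty : ∀ {n k} (p : Subset n) → ∣ p ∣ˢ ≡ suc k → Nonempty p
∣p∣≡suc⇒Nonempty (inside  ∷ p) _ = zero , here
∣p∣≡suc⇒Nonempty (outside ∷ p) h =
  let x , x∈p = ∣p∣≡suc⇒Nonempty p h in suc x , there x∈p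

x∈p⇒∣p∣≡1+∣p-x∣ : ∀ {n x} {p : Subset n} → x ∈ p → ∣ p ∣ˢ ≡ suc ∣ p -ˢ x ∣ˢ
x∈p⇒∣p∣≡1+∣p-x∣ {p = _ ∷ p} here = cong (λ q → suc ∣ q ∣ˢ) (sym (p─⊥≡p p))
x∈p⇒∣p∣≡1+∣p-x∣ {p = inside  ∷ _} (there x∈p) = cong suc (x∈p⇒∣p∣≡1+∣p-x∣ x∈p)
x∈p⇒∣p∣≡1+∣p-x∣ {p = outside ∷ _} (there x∈p) = x∈p⇒∣p∣≡1+∣p-x∣ x∈p

x∈p⇒⁅x⁆∪[p-x]≡p : ∀ {n x} {p : Subset n} → x ∈ p → ⁅ x ⁆ ∪ (p -ˢ x) ≡ p
x∈p⇒⁅x⁆∪[p-x]≡p {p = _ ∷ p} here =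
  cong (inside ∷_) (trans (∪-identityˡ _) (p─⊥≡p p))
x∈p⇒⁅x⁆∪[p-x]≡p (there x∈p) = cong (_ ∷_) (x∈p⇒⁅x⁆∪[p-x]≡p x∈p)

x∈p⇒⁅x⁆∪p≡p : ∀ {n x} {p : Subset n} → x ∈ p → ⁅ x ⁆ ∪ p ≡ p
x∈p⇒⁅x⁆∪p≡p {p = _ ∷ p} here = cong (inside ∷_) (∪-identityˡ p)
x∈p⇒⁅x⁆∪p≡p (there x∈p) = cong (_ ∷_) (x∈p⇒⁅x⁆∪p≡p x∈p)

x∈⁅x⁆∪p : ∀ {n} (x : Fin n) (p : Subset n) → x ∈ ⁅ x ⁆ ∪ p
x∈⁅x⁆∪p x p = x∈p∪q⁺ (inj₁ (x∈⁅x⁆ x))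

x∉p⇒⁅x⁆∪p-x≡p : ∀ {n} (x : Fin n) (p : Subset n) → x ∉ p → (⁅ x ⁆ ∪ p) -ˢ x ≡ p
x∉p⇒⁅x⁆∪p-x≡p zero    (inside  ∷ p) x∉p = contradiction here x∉p
x∉p⇒⁅x⁆∪p-x≡p zero    (outside ∷ p) x∉p =
  cong (outside ∷_) (trans (p─⊥≡p _) (∪-identityˡ p))
x∉p⇒⁅x⁆∪p-x≡p (suc x) (_ ∷ p)       x∉p =
  cong (_ ∷_) (x∉p⇒⁅x⁆∪p-x≡p x p λ x∈p → x∉p (there x∈p))

x∉p⇒∣⁅x⁆∪p∣≡1+∣p∣ : ∀ {n} (x : Fin n) (p : Subset n) → x ∉ p → ∣ ⁅ x ⁆ ∪ p ∣ˢ ≡ suc ∣ p ∣ˢ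
x∉p⇒∣⁅x⁆∪p∣≡1+∣p∣ x p x∉p =
  trans (x∈p⇒∣p∣≡1+∣p-x∣ (x∈⁅x⁆∪p x p)) (cong (λ q → suc ∣ q ∣ˢ) (x∉p⇒⁅x⁆∪p-x≡p x p x∉p))

bit : ∀ {n} → Subset n → Fin n → ℕ
bit V j = if lookup V j then 1 else 0

-- Counts entries with multiplicity, hence is additive along the tuple; it agrees with the size of
-- `setOf is ∩ V` when the entries are distinct.
hits : ∀ {n r} → Subset n → Vec (Fin n) r → ℕ
hits V is = Vec.sum (Vec.map (bit V) is)

∣[⁅x⁆∪p]∩V∣ : ∀ {n} (V : Subset n) (x : Fin n) (p : Subset n) → x ∉ p →
  ∣ (⁅ x ⁆ ∪ p) ∩ V ∣ˢ ≡ bit V x ℕ.+ ∣ p ∩ V ∣ˢ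
∣[⁅x⁆∪p]∩V∣ (v ∷ V) zero (inside ∷ p) x∉p = contradiction here x∉p
∣[⁅x⁆∪p]∩V∣ (true ∷ V) zero (outside ∷ p) x∉p = cong (λ q → suc ∣ q ∩ V ∣ˢ) (∪-identityˡ p)
∣[⁅x⁆∪p]∩V∣ (false ∷ V) zero (outside ∷ p) x∉p = cong (λ q → ∣ q ∩ V ∣ˢ) (∪-identityˡ p)
∣[⁅x⁆∪p]∩V∣ (true ∷ V) (suc x) (inside ∷ p) x∉p =
  trans (cong suc (∣[⁅x⁆∪p]∩V∣ V x p λ x∈p → x∉p (there x∈p))) (sym (ℕ.+-suc _ _))
∣[⁅x⁆∪p]∩V∣ (true ∷ V) (suc x) (outside ∷ p) x∉p = ∣[⁅x⁆∪p]∩V∣ V x p λ x∈p → x∉p (there x∈p)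
∣[⁅x⁆∪p]∩V∣ (false ∷ V) (suc x) (inside ∷ p) x∉p = ∣[⁅x⁆∪p]∩V∣ V x p λ x∈p → x∉p (there x∈p)
∣[⁅x⁆∪p]∩V∣ (false ∷ V) (suc x) (outside ∷ p) x∉p = ∣[⁅x⁆∪p]∩V∣ V x p λ x∈p → x∉p (there x∈p)

∣setOf∣≤ : ∀ {n r} (is : Vec (Fin n) r) → ∣ setOf is ∣ˢ ℕ.≤ r
∣setOf∣≤ {n} [] = ℕ.≤-reflexive (∣⊥∣≡0 n)
∣setOf∣≤ (i ∷ is) with i ∈? setOf is
... | yes i∈ = subst (λ p → ∣ p ∣ˢ ℕ.≤ _) (sym (x∈p⇒⁅x⁆∪p≡p i∈)) (ℕ.m≤n⇒m≤1+n (∣setOf∣≤ is))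
... | no  i∉ = subst (ℕ._≤ _) (sym (x∉p⇒∣⁅x⁆∪p∣≡1+∣p∣ i (setOf is) i∉)) (ℕ.s≤s (∣setOf∣≤ is))

-- A repeated `i` would leave the set of the whole tuple equal to that of its tail, which has at
-- most `r` elements.
setOf-distinct-∉ : ∀ {n r} (i : Fin n) (is : Vec (Fin n) r) → ∣ setOf (i ∷ is) ∣ˢ ≡ suc r → i ∉ setOf is
setOf-distinct-∉ i is h i∈ =
  ℕ.<-irrefl refl (subst (ℕ._≤ _) (trans (cong ∣_∣ˢ (sym (x∈p⇒⁅x⁆∪p≡p i∈))) h) (∣setOf∣≤ is))

setOf-distinct-tail : ∀ {n r} (i : Fin n) (is : Vec (Fin n) r) → ∣ setOf (i ∷ is) ∣ˢ ≡ suc r → ∣ setOf is ∣ˢ ≡ r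
setOf-distinct-tail i is h =
  ℕ.suc-injective (trans (sym (x∉p⇒∣⁅x⁆∪p∣≡1+∣p∣ i (setOf is) (setOf-distinct-∉ i is h))) h)

∣setOf∩V∣≡hits : ∀ {n r} (V : Subset n) (is : Vec (Fin n) r) → ∣ setOf is ∣ˢ ≡ r → ∣ setOf is ∩ V ∣ˢ ≡ hits V is
∣setOf∩V∣≡hits {n} V [] _ = trans (cong ∣_∣ˢ (∩-zeroˡ V)) (∣⊥∣≡0 n)
∣setOf∩V∣≡hits V (i ∷ is) h =
  trans (∣[⁅x⁆∪p]∩V∣ V i (setOf is) (setOf-distinct-∉ i is h))
        (cong (bit V i ℕ.+_) (∣setOf∩V∣≡hits V is (setOf-distinct-tail i is h)))

setOf-∷⁻ : ∀ {n r} {e : Subset n} (i : Fin n) (is : Vec (Fin n) r) → ∣ e ∣ˢ ≡ suc r →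
  setOf (i ∷ is) ≡ e → setOf is ≡ e -ˢ i
setOf-∷⁻ i is h refl = sym (x∉p⇒⁅x⁆∪p-x≡p i (setOf is) (setOf-distinct-∉ i is h))

setOf-∷⁺ : ∀ {n r} {e : Subset n} {i : Fin n} (is : Vec (Fin n) r) → i ∈ e →
  setOf is ≡ e -ˢ i → setOf (i ∷ is) ≡ e
setOf-∷⁺ {i = i} is i∈e eq = trans (cong (⁅ i ⁆ ∪_) eq) (x∈p⇒⁅x⁆∪[p-x]≡p i∈e)

∣p-x∣≡ : ∀ {n r x} {p : Subset n} → x ∈ p → ∣ p ∣ˢ ≡ suc r → ∣ p -ˢ x ∣ˢ ≡ r
∣p-x∣≡ x∈p h = ℕ.suc-injective (trans (sym (x∈p⇒∣p∣≡1+∣p-x∣ x∈p)) h)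

enumerate : ∀ {n} r (e : Subset n) → ∣ e ∣ˢ ≡ r → ∃ λ (is : Vec (Fin n) r) → setOf is ≡ e
enumerate zero    e h = [] , sym (∣p∣≡0⇒p≡⊥ h)
enumerate (suc r) e h =
  let i , i∈e = ∣p∣≡suc⇒Nonempty e h
      is , eq = enumerate r (e -ˢ i) (∣p-x∣≡ i∈e h)
  in i ∷ is , setOf-∷⁺ is i∈e eq

-- Any vertex of an edge can be listed first, so the row of the tensor at an arbitrary vertex
-- carries information about each edge through it.
enumerateFrom : ∀ {n r} {e : Subset n} {i} → ∣ e ∣ˢ ≡ suc r → i ∈ e →
  ∃ λ (is : Vec (Fin n) r) → setOf (i ∷ is) ≡ e
enumerateFrom {r = r} {e} {i} h i∈e =
  let is , eq = enumerate r (e -ˢ i) (∣p-x∣≡ i∈e h) in is , setOf-∷⁺ is i∈e eq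

∈setOf⇒lookup : ∀ {n r} {j : Fin n} (is : Vec (Fin n) r) → j ∈ setOf is → ∃ λ t → lookup is t ≡ j
∈setOf⇒lookup [] j∈ = contradiction j∈ ∉⊥
∈setOf⇒lookup (i ∷ is) j∈ with x∈p∪q⁻ ⁅ i ⁆ (setOf is) j∈
... | inj₁ j∈⁅i⁆ = zero , sym (x∈⁅y⁆⇒x≡y i j∈⁅i⁆)
... | inj₂ j∈is  = let t , eq = ∈setOf⇒lookup is j∈is in suc t , eq

-- Sums and products over tuples of rationals

-- A multiple of `1ℚ`, so that inductions on `m` compute and `×1-homo-*` handles products; `/1≡natℚ`
-- ties it to the fractions in the tensors.
natℚ : ℕ → ℚ
natℚ m = m ×ℚ 1ℚ

*-nonNeg : ∀ {p q} → 0ℚ ≤ p → 0ℚ ≤ q → 0ℚ ≤ p * q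
*-nonNeg {p} {q} 0≤p 0≤q =
  ℚ.nonNegative⁻¹ (p * q) {{ℚ.nonNeg*nonNeg⇒nonNeg p {{nonNegative 0≤p}} q {{nonNegative 0≤q}}}}

*-monoˡ-≤ : ∀ r {p q} → 0ℚ ≤ r → p ≤ q → r * p ≤ r * q
*-monoˡ-≤ r 0≤r p≤q = ℚ.*-monoˡ-≤-nonNeg r {{nonNegative 0≤r}} p≤q

*-monoʳ-≤ : ∀ r {p q} → 0ℚ ≤ r → p ≤ q → p * r ≤ q * r
*-monoʳ-≤ r 0≤r p≤q = ℚ.*-monoʳ-≤-nonNeg r {{nonNegative 0≤r}} p≤q

p≤q⇒0≤q-p : ∀ p q → p ≤ q → 0ℚ ≤ q - p
p≤q⇒0≤q-p p q p≤q = subst (_≤ q - p) (ℚ.+-inverseʳ p) (ℚ.+-monoˡ-≤ (- p) p≤q)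

+-nonNeg : ∀ {p q} → 0ℚ ≤ p → 0ℚ ≤ q → 0ℚ ≤ p + q
+-nonNeg 0≤p 0≤q = ℚ.+-mono-≤ 0≤p 0≤q

0≤1 : 0ℚ ≤ 1ℚ
0≤1 = ℚ.nonNegative⁻¹ 1ℚ

0≤natℚ : ∀ m → 0ℚ ≤ natℚ m
0≤natℚ zero    = ℚ.≤-refl
0≤natℚ (suc m) = +-nonNeg 0≤1 (0≤natℚ m)

p≤∣p∣ : ∀ p → p ≤ ∣ p ∣
p≤∣p∣ p with ℚ.≤-total 0ℚ p
... | inj₁ 0≤p = ℚ.≤-reflexive (sym (ℚ.0≤p⇒∣p∣≡p 0≤p))
... | inj₂ p≤0 = ℚ.≤-trans p≤0 (ℚ.0≤∣p∣ p)

-p≤∣p∣ : ∀ p → - p ≤ ∣ p ∣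
-p≤∣p∣ p = subst (- p ≤_) (ℚ.∣-p∣≡∣p∣ p) (p≤∣p∣ (- p))

-- `_/_` normalises by a gcd, which is stuck on an open `m`; the detour through unnormalised
-- rationals avoids it.
/1-suc : ∀ m → ℤ.+ suc m / 1 ≡ 1ℚ + (ℤ.+ m / 1)
/1-suc m = ℚ.toℚᵘ-injective (begin
  toℚᵘ (ℤ.+ suc m / 1)                  ≈⟨ ℚ.toℚᵘ-fromℚᵘ (ℚᵘ.mkℚᵘ (ℤ.+ suc m) 0) ⟩
  ℚᵘ.mkℚᵘ (ℤ.+ suc m) 0
    ≈⟨ ℚᵘ.*≡* (cong (ℤ._* ℤ.+ 1) (cong (ℤ._+_ 1ℤ) (sym (ℤ.*-identityʳ (ℤ.+ m))))) ⟩
  toℚᵘ 1ℚ ℚᵘ.+ ℚᵘ.mkℚᵘ (ℤ.+ m) 0        ≈⟨ ℚᵘ.+-congʳ (toℚᵘ 1ℚ) (ℚ.toℚᵘ-fromℚᵘ (ℚᵘ.mkℚᵘ (ℤ.+ m) 0)) ⟨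
  toℚᵘ 1ℚ ℚᵘ.+ toℚᵘ (ℤ.+ m / 1)         ≈⟨ ℚ.toℚᵘ-homo-+ 1ℚ (ℤ.+ m / 1) ⟨
  toℚᵘ (1ℚ + (ℤ.+ m / 1))               ∎)
  where open ℚᵘ.≃-Reasoning

/1≡natℚ : ∀ m → ℤ.+ m / 1 ≡ natℚ m
/1≡natℚ zero    = refl
/1≡natℚ (suc m) = trans (/1-suc m) (cong (1ℚ +_) (/1≡natℚ m))

1/d*d≡1 : ∀ d .{{_ : ℕ.NonZero d}} → (1ℤ / d) * natℚ d ≡ 1ℚ
1/d*d≡1 (suc d) = trans (cong (1ℤ / suc d *_) (sym (/1≡natℚ (suc d)))) (ℚ.toℚᵘ-injective (begin
  toℚᵘ ((1ℤ / suc d) * (ℤ.+ suc d / 1))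
    ≈⟨ ℚ.toℚᵘ-homo-* (1ℤ / suc d) (ℤ.+ suc d / 1) ⟩
  toℚᵘ (1ℤ / suc d) ℚᵘ.* toℚᵘ (ℤ.+ suc d / 1)
    ≈⟨ ℚᵘ.*-cong (ℚ.toℚᵘ-fromℚᵘ (ℚᵘ.mkℚᵘ 1ℤ d)) (ℚ.toℚᵘ-fromℚᵘ (ℚᵘ.mkℚᵘ (ℤ.+ suc d) 0)) ⟩
  ℚᵘ.mkℚᵘ 1ℤ d ℚᵘ.* ℚᵘ.mkℚᵘ (ℤ.+ suc d) 0
    ≈⟨ ℚᵘ.*≡* (trans (ℤ.*-identityʳ _) (trans (ℤ.*-identityˡ (ℤ.+ suc d))
         (cong ℤ.+_ (sym (trans (cong (ℕ._+ 0) (ℕ.*-identityʳ (suc d))) (ℕ.+-identityʳ (suc d))))))) ⟩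
  toℚᵘ 1ℚ ∎))
  where
  open ℚᵘ.≃-Reasoning

Σᵗ : ∀ {n} r → (Vec (Fin n) r → ℚ) → ℚ
Σᵗ zero    f = f []
Σᵗ (suc r) f = sum λ i → Σᵗ r λ is → f (i ∷ is)

∏ᵗ : ∀ {n r} → (Fin n → ℚ) → Vec (Fin n) r → ℚ
∏ᵗ x is = product λ j → x (lookup is j)

Σᵗ-cong : ∀ {n} r {f g : Vec (Fin n) r → ℚ} → (∀ is → f is ≡ g is) → Σᵗ r f ≡ Σᵗ r g
Σᵗ-cong zero    f≡g = f≡g []
Σᵗ-cong (suc r) f≡g = sum-cong-≗ λ i → Σᵗ-cong r λ is → f≡g (i ∷ is)

Σᵗ-distrib-+ : ∀ {n} r (f g : Vec (Fin n) r → ℚ) → Σᵗ r (λ is → f is + g is) ≡ Σᵗ r f + Σᵗ r g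
Σᵗ-distrib-+ zero    f g = refl
Σᵗ-distrib-+ {n} (suc r) f g = trans
  (sum-cong-≗ λ i → Σᵗ-distrib-+ r (λ is → f (i ∷ is)) (λ is → g (i ∷ is)))
  (∑-distrib-+ {n} (λ i → Σᵗ r λ is → f (i ∷ is)) (λ i → Σᵗ r λ is → g (i ∷ is)))

*-distribˡ-Σᵗ : ∀ {n} r c (f : Vec (Fin n) r → ℚ) → c * Σᵗ r f ≡ Σᵗ r (λ is → c * f is)
*-distribˡ-Σᵗ zero    c f = refl
*-distribˡ-Σᵗ (suc r) c f = trans
  (*-distribˡ-sum c (λ i → Σᵗ r λ is → f (i ∷ is)))
  (sum-cong-≗ λ i → *-distribˡ-Σᵗ r c λ is → f (i ∷ is))

Σᵗ-zero : ∀ {n} r {f : Vec (Fin n) r → ℚ} → (∀ is → f is ≡ 0ℚ) → Σᵗ r f ≡ 0ℚ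
Σᵗ-zero zero    f≡0 = f≡0 []
Σᵗ-zero {n} (suc r) f≡0 = trans
  (sum-cong-≗ λ i → Σᵗ-zero r λ is → f≡0 (i ∷ is)) (sum-replicate-zero n)

sum-nonNeg : ∀ {n} (f : Fin n → ℚ) → (∀ i → 0ℚ ≤ f i) → 0ℚ ≤ sum f
sum-nonNeg {zero}  f 0≤f = ℚ.≤-refl
sum-nonNeg {suc n} f 0≤f = +-nonNeg (0≤f zero) (sum-nonNeg (λ i → f (suc i)) λ i → 0≤f (suc i))

term≤sum : ∀ {n} (f : Fin n → ℚ) → (∀ i → 0ℚ ≤ f i) → ∀ i → f i ≤ sum f
term≤sum f 0≤f zero    = subst (_≤ sum f) (ℚ.+-identityʳ (f zero))
  (ℚ.+-monoʳ-≤ (f zero) (sum-nonNeg (λ i → f (suc i)) λ i → 0≤f (suc i)))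
term≤sum f 0≤f (suc i) = subst (_≤ sum f) (ℚ.+-identityˡ (f (suc i)))
  (ℚ.+-mono-≤ (0≤f zero) (term≤sum (λ i → f (suc i)) (λ i → 0≤f (suc i)) i))

Σᵗ-nonNeg : ∀ {n} r (f : Vec (Fin n) r → ℚ) → (∀ is → 0ℚ ≤ f is) → 0ℚ ≤ Σᵗ r f
Σᵗ-nonNeg zero    f 0≤f = 0≤f []
Σᵗ-nonNeg (suc r) f 0≤f = sum-nonNeg (λ i → Σᵗ r λ is → f (i ∷ is)) λ i →
  Σᵗ-nonNeg r (λ is → f (i ∷ is)) λ is → 0≤f (i ∷ is)

term≤Σᵗ : ∀ {n} r (f : Vec (Fin n) r → ℚ) → (∀ is → 0ℚ ≤ f is) → ∀ is → f is ≤ Σᵗ r f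
term≤Σᵗ zero    f 0≤f []       = ℚ.≤-refl
term≤Σᵗ (suc r) f 0≤f (i ∷ is) = ℚ.≤-trans
  (term≤Σᵗ r (λ is → f (i ∷ is)) (λ is → 0≤f (i ∷ is)) is)
  (term≤sum (λ i → Σᵗ r λ is → f (i ∷ is))
    (λ i → Σᵗ-nonNeg r (λ is → f (i ∷ is)) λ is → 0≤f (i ∷ is)) i)

∏ᵗ-distrib-* : ∀ {n r} (x y : Fin n → ℚ) (is : Vec (Fin n) r) →
  ∏ᵗ (λ j → x j * y j) is ≡ ∏ᵗ x is * ∏ᵗ y is
∏ᵗ-distrib-* {r = r} x y is = ∏-distrib-* {r} (λ j → x (lookup is j)) (λ j → y (lookup is j))

∏ᵗ-const : ∀ {n r} c (is : Vec (Fin n) r) → ∏ᵗ (λ _ → c) is ≡ c ^ r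
∏ᵗ-const c []       = refl
∏ᵗ-const c (i ∷ is) = cong (c *_) (∏ᵗ-const c is)

∣∏ᵗ∣ : ∀ {n r} (x : Fin n → ℚ) (is : Vec (Fin n) r) → ∣ ∏ᵗ x is ∣ ≡ ∏ᵗ (λ j → ∣ x j ∣) is
∣∏ᵗ∣ x []       = refl
∣∏ᵗ∣ x (i ∷ is) = trans (ℚ.∣p*q∣≡∣p∣*∣q∣ (x i) (∏ᵗ x is)) (cong (∣ x i ∣ *_) (∣∏ᵗ∣ x is))

p*q≤p : ∀ p {q} → 0ℚ ≤ p → q ≤ 1ℚ → p * q ≤ p
p*q≤p p {q} 0≤p q≤1 = subst (p * q ≤_) (ℚ.*-identityʳ p) (*-monoˡ-≤ p 0≤p q≤1)

p*q≤q : ∀ {p} q → 0ℚ ≤ q → p ≤ 1ℚ → p * q ≤ q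
p*q≤q {p} q 0≤q p≤1 = subst (p * q ≤_) (ℚ.*-identityˡ q) (*-monoʳ-≤ q 0≤q p≤1)

∏ᵗ-nonNeg : ∀ {n r} {x : Fin n → ℚ} → (∀ j → 0ℚ ≤ x j) → (is : Vec (Fin n) r) → 0ℚ ≤ ∏ᵗ x is
∏ᵗ-nonNeg 0≤x []       = 0≤1
∏ᵗ-nonNeg 0≤x (i ∷ is) = *-nonNeg (0≤x i) (∏ᵗ-nonNeg 0≤x is)

∏ᵗ≤1 : ∀ {n r} {x : Fin n → ℚ} → (∀ j → 0ℚ ≤ x j) → (∀ j → x j ≤ 1ℚ) →
  (is : Vec (Fin n) r) → ∏ᵗ x is ≤ 1ℚ
∏ᵗ≤1 0≤x x≤1 []       = ℚ.≤-refl
∏ᵗ≤1 {x = x} 0≤x x≤1 (i ∷ is) = ℚ.≤-trans (p*q≤p (x i) (0≤x i) (∏ᵗ≤1 0≤x x≤1 is)) (x≤1 i)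

∏ᵗ≤factor : ∀ {n r} {x : Fin n → ℚ} → (∀ j → 0ℚ ≤ x j) → (∀ j → x j ≤ 1ℚ) →
  (is : Vec (Fin n) r) → ∀ t → ∏ᵗ x is ≤ x (lookup is t)
∏ᵗ≤factor {x = x} 0≤x x≤1 (i ∷ is) zero    = p*q≤p (x i) (0≤x i) (∏ᵗ≤1 0≤x x≤1 is)
∏ᵗ≤factor {x = x} 0≤x x≤1 (i ∷ is) (suc t) =
  ℚ.≤-trans (p*q≤q (∏ᵗ x is) (∏ᵗ-nonNeg 0≤x is) (x≤1 i)) (∏ᵗ≤factor 0≤x x≤1 is t)

^-nonNeg : ∀ {a} r → 0ℚ ≤ a → 0ℚ ≤ a ^ r
^-nonNeg zero    0≤a = 0≤1
^-nonNeg (suc r) 0≤a = *-nonNeg 0≤a (^-nonNeg r 0≤a)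

^≤1 : ∀ {a} r → 0ℚ ≤ a → a ≤ 1ℚ → a ^ r ≤ 1ℚ
^≤1 zero    0≤a a≤1 = ℚ.≤-refl
^≤1 {a} (suc r) 0≤a a≤1 = ℚ.≤-trans (p*q≤p a 0≤a (^≤1 r 0≤a a≤1)) a≤1

-- A Bernoulli-type inequality, by `1 - a b = (1 - a) + a (1 - b)`. Its linearity in `1ℚ - a` keeps
-- all later error bounds linear in `η`.
1-^≤ : ∀ {a} r → 0ℚ ≤ a → a ≤ 1ℚ → 1ℚ - a ^ r ≤ natℚ r * (1ℚ - a)
1-^≤ {a} zero    0≤a a≤1 = ℚ.≤-reflexive (trans (ℚ.+-inverseʳ 1ℚ) (sym (ℚ.*-zeroˡ (1ℚ - a))))
1-^≤ {a} (suc r) 0≤a a≤1 = begin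
  1ℚ - a * a ^ r                       ≡⟨ split a (a ^ r) ⟩
  (1ℚ - a) + a * (1ℚ - a ^ r)
    ≤⟨ ℚ.+-monoʳ-≤ (1ℚ - a) (p*q≤q (1ℚ - a ^ r) (p≤q⇒0≤q-p (a ^ r) 1ℚ (^≤1 r 0≤a a≤1)) a≤1) ⟩
  (1ℚ - a) + (1ℚ - a ^ r)              ≤⟨ ℚ.+-monoʳ-≤ (1ℚ - a) (1-^≤ r 0≤a a≤1) ⟩
  (1ℚ - a) + natℚ r * (1ℚ - a)         ≡⟨ join (natℚ r) (1ℚ - a) ⟩
  (1ℚ + natℚ r) * (1ℚ - a)             ∎
  where
  open ℚ.≤-Reasoning
  split : ∀ a b → 1ℚ - a * b ≡ (1ℚ - a) + a * (1ℚ - b)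
  split = solve 2 (λ a b → con 1ℚ :- a :* b := (con 1ℚ :- a) :+ a :* (con 1ℚ :- b)) refl
  join : ∀ m u → u + m * u ≡ (1ℚ + m) * u
  join = solve 2 (λ m u → u :+ m :* u := (con 1ℚ :+ m) :* u) refl

-- Counting the tuples of an edge

⟦_⟧ : ∀ {A : Set} → Dec A → ℚ
⟦ a? ⟧ = if ⌊ a? ⌋ then 1ℚ else 0ℚ

⟦⟧-⇔ : ∀ {A B : Set} → (A → B) → (B → A) → (a? : Dec A) (b? : Dec B) → ⟦ a? ⟧ ≡ ⟦ b? ⟧
⟦⟧-⇔ f g (yes a) (yes b) = refl
⟦⟧-⇔ f g (yes a) (no ¬b) = contradiction (f a) ¬b
⟦⟧-⇔ f g (no ¬a) (yes b) = contradiction (g b) ¬a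
⟦⟧-⇔ f g (no ¬a) (no ¬b) = refl

⟦⟧-no : ∀ {A : Set} → ¬ A → (a? : Dec A) → ⟦ a? ⟧ ≡ 0ℚ
⟦⟧-no ¬a (yes a) = contradiction a ¬a
⟦⟧-no ¬a (no _)  = refl

⟦⟧-⊎ : ∀ {A B C : Set} → (A → C) → (B → C) → (C → A ⊎ B) → (A → ¬ B) →
  (a? : Dec A) (b? : Dec B) (c? : Dec C) → ⟦ c? ⟧ ≡ ⟦ a? ⟧ + ⟦ b? ⟧
⟦⟧-⊎ f g h k (yes a) (yes b) _       = contradiction b (k a)
⟦⟧-⊎ f g h k (yes a) (no ¬b) (yes c) = refl
⟦⟧-⊎ f g h k (yes a) (no ¬b) (no ¬c) = contradiction (f a) ¬c
⟦⟧-⊎ f g h k (no ¬a) (yes b) (yes c) = refl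
⟦⟧-⊎ f g h k (no ¬a) (yes b) (no ¬c) = contradiction (g b) ¬c
⟦⟧-⊎ f g h k (no ¬a) (no ¬b) (no ¬c) = refl
⟦⟧-⊎ f g h k (no ¬a) (no ¬b) (yes c) with h c
... | inj₁ a = contradiction a ¬a
... | inj₂ b = contradiction b ¬b

⟦⟧-× : ∀ {A B C : Set} → (A → B → C) → (C → A × B) →
  (a? : Dec A) (b? : Dec B) (c? : Dec C) → ⟦ c? ⟧ ≡ ⟦ a? ⟧ * ⟦ b? ⟧
⟦⟧-× f g (yes a) (yes b) (yes c) = refl
⟦⟧-× f g (yes a) (yes b) (no ¬c) = contradiction (f a b) ¬c
⟦⟧-× f g (yes a) (no ¬b) c?      = ⟦⟧-no (λ c → ¬b (proj₂ (g c))) c?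
⟦⟧-× f g (no ¬a) b?      c?      =
  trans (⟦⟧-no (λ c → ¬a (proj₁ (g c))) c?) (sym (ℚ.*-zeroˡ ⟦ b? ⟧))

0≤⟦⟧ : ∀ {A : Set} (a? : Dec A) → 0ℚ ≤ ⟦ a? ⟧
0≤⟦⟧ (yes _) = 0≤1
0≤⟦⟧ (no  _) = ℚ.≤-refl

sum-⟦∈⟧ : ∀ {n} (p : Subset n) → sum (λ i → ⟦ i ∈? p ⟧) ≡ natℚ ∣ p ∣ˢ
sum-⟦∈⟧ [] = refl
sum-⟦∈⟧ (s ∷ p) with s
... | true  = cong (_+_ 1ℚ) (trans (sum-cong-≗ λ i →
  ⟦⟧-⇔ (λ { (there i∈p) → i∈p }) there (suc i ∈? (inside ∷ p)) (i ∈? p)) (sum-⟦∈⟧ p))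
... | false = trans (ℚ.+-identityˡ _) (trans (sum-cong-≗ λ i →
  ⟦⟧-⇔ (λ { (there i∈p) → i∈p }) there (suc i ∈? (outside ∷ p)) (i ∈? p)) (sum-⟦∈⟧ p))

sum-⟦≟⟧ : ∀ {n} (i : Fin n) (f : Fin n → ℚ) → sum (λ j → ⟦ i Fin.≟ j ⟧ * f j) ≡ f i
sum-⟦≟⟧ {suc n} zero f = trans
  (cong₂ _+_ (ℚ.*-identityˡ (f zero))
    (trans (sum-cong-≗ λ j → ℚ.*-zeroˡ (f (suc j))) (sum-replicate-zero n)))
  (ℚ.+-identityʳ (f zero))
sum-⟦≟⟧ (suc i) f = trans
  (cong₂ _+_ (ℚ.*-zeroˡ (f zero))
    (trans (sum-cong-≗ λ j → cong (_* f (suc j))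
       (⟦⟧-⇔ Fin.suc-injective (cong suc) (suc i Fin.≟ suc j) (i Fin.≟ j)))
     (sum-⟦≟⟧ i (λ j → f (suc j)))))
  (ℚ.+-identityˡ (f (suc i)))

-- Mutual with `Σᵗ-setOf-∷≡`: the first entry runs over the elements of `e`, and the remaining
-- entries enumerate `e` without it.
Σᵗ-setOf≡ : ∀ {n} r (e : Subset n) → ∣ e ∣ˢ ≡ r →
  Σᵗ r (λ is → ⟦ setOf is ≟ˢ e ⟧) ≡ natℚ (r !)

Σᵗ-setOf-∷≡ : ∀ {n} r (e : Subset n) → ∣ e ∣ˢ ≡ suc r → ∀ i →
  Σᵗ r (λ is → ⟦ setOf (i ∷ is) ≟ˢ e ⟧) ≡ ⟦ i ∈? e ⟧ * natℚ (r !)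

Σᵗ-setOf≡ zero e h = ⟦⟧-⇔ {B = ∣ e ∣ˢ ≡ 0} (λ _ → h) (λ _ → sym (∣p∣≡0⇒p≡⊥ h)) (setOf [] ≟ˢ e) (yes h)
Σᵗ-setOf≡ (suc r) e h = begin
  sum (λ i → Σᵗ r λ is → ⟦ setOf (i ∷ is) ≟ˢ e ⟧)  ≡⟨ sum-cong-≗ (Σᵗ-setOf-∷≡ r e h) ⟩
  sum (λ i → ⟦ i ∈? e ⟧ * natℚ (r !))              ≡⟨ *-distribʳ-sum (natℚ (r !)) (λ i → ⟦ i ∈? e ⟧) ⟨
  sum (λ i → ⟦ i ∈? e ⟧) * natℚ (r !)              ≡⟨ cong (_* natℚ (r !)) (trans (sum-⟦∈⟧ e) (cong natℚ h)) ⟩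
  natℚ (suc r) * natℚ (r !)                        ≡⟨ ×1-homo-* (suc r) (r !) ⟨
  natℚ (suc r !)                                   ∎
  where open ≡-Reasoning

Σᵗ-setOf-∷≡ r e h i with i ∈? e
... | yes i∈e = begin
  Σᵗ r (λ is → ⟦ setOf (i ∷ is) ≟ˢ e ⟧)
    ≡⟨ Σᵗ-cong r (λ is → ⟦⟧-⇔ (setOf-∷⁻ i is h) (setOf-∷⁺ is i∈e)
         (setOf (i ∷ is) ≟ˢ e) (setOf is ≟ˢ (e -ˢ i))) ⟩
  Σᵗ r (λ is → ⟦ setOf is ≟ˢ (e -ˢ i) ⟧)      ≡⟨ Σᵗ-setOf≡ r (e -ˢ i) (∣p-x∣≡ i∈e h) ⟩
  natℚ (r !)                                  ≡⟨ ℚ.*-identityˡ (natℚ (r !)) ⟨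
  1ℚ * natℚ (r !)                             ∎
  where open ≡-Reasoning
... | no i∉e = trans
  (Σᵗ-zero r λ is → ⟦⟧-no (λ eq → i∉e (subst (i ∈_) eq (x∈⁅x⁆∪p i (setOf is)))) (setOf (i ∷ is) ≟ˢ e))
  (sym (ℚ.*-zeroˡ (natℚ (r !))))

natℚ-length-filter : ∀ {A : Set} {P : A → Set} (P? : ∀ a → Dec (P a)) a as →
  natℚ (length (filter P? (a ∷ as))) ≡ ⟦ P? a ⟧ + natℚ (length (filter P? as))
natℚ-length-filter P? a as with P? a
... | yes _ = refl
... | no  _ = sym (ℚ.+-identityˡ (natℚ (length (filter P? as))))

Σᵗ-setOf-∷∈ : ∀ {n} r (es : List (Subset n)) → All (λ e → ∣ e ∣ˢ ≡ suc r) es → Unique es → ∀ i →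
  Σᵗ r (λ is → ⟦ setOf (i ∷ is) ∈ₗ? es ⟧) ≡ natℚ (length (filter (i ∈?_) es)) * natℚ (r !)
Σᵗ-setOf-∷∈ r [] _ _ i = trans (Σᵗ-zero r λ _ → refl) (sym (ℚ.*-zeroˡ (natℚ (r !))))
Σᵗ-setOf-∷∈ r (e ∷ es) (h ∷ hs) (e≢ ∷ u) i = begin
  Σᵗ r (λ is → ⟦ setOf (i ∷ is) ∈ₗ? (e ∷ es) ⟧)
    ≡⟨ Σᵗ-cong r (λ is → ⟦⟧-⊎ here there
         (λ { (here eq) → inj₁ eq ; (there s∈) → inj₂ s∈ })
         -- Uniqueness makes the alternatives exclusive: a tuple whose set is `e` cannot also match
         -- an edge of the remaining list.
         (λ eq s∈ → All.lookup e≢ s∈ (sym eq))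
         (setOf (i ∷ is) ≟ˢ e) (setOf (i ∷ is) ∈ₗ? es) (setOf (i ∷ is) ∈ₗ? (e ∷ es))) ⟩
  Σᵗ r (λ is → ⟦ setOf (i ∷ is) ≟ˢ e ⟧ + ⟦ setOf (i ∷ is) ∈ₗ? es ⟧)
    ≡⟨ Σᵗ-distrib-+ r (λ is → ⟦ setOf (i ∷ is) ≟ˢ e ⟧) (λ is → ⟦ setOf (i ∷ is) ∈ₗ? es ⟧) ⟩
  Σᵗ r (λ is → ⟦ setOf (i ∷ is) ≟ˢ e ⟧) + Σᵗ r (λ is → ⟦ setOf (i ∷ is) ∈ₗ? es ⟧)
    ≡⟨ cong₂ _+_ (Σᵗ-setOf-∷≡ r e h i) (Σᵗ-setOf-∷∈ r es hs u i) ⟩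
  ⟦ i ∈? e ⟧ * natℚ (r !) + natℚ (length (filter (i ∈?_) es)) * natℚ (r !)
    ≡⟨ ℚ.*-distribʳ-+ (natℚ (r !)) ⟦ i ∈? e ⟧ (natℚ (length (filter (i ∈?_) es))) ⟨
  (⟦ i ∈? e ⟧ + natℚ (length (filter (i ∈?_) es))) * natℚ (r !)
    ≡⟨ cong (_* natℚ (r !)) (natℚ-length-filter (i ∈?_) e es) ⟨
  natℚ (length (filter (i ∈?_) (e ∷ es))) * natℚ (r !) ∎
  where open ≡-Reasoning

-- The indicator of a constant tuple factors over its entries, so each summation collapses to the
-- single index `i`.
Σᵗ-diagonal : ∀ {n} r (x : Fin n → ℚ) i →
  Σᵗ r (λ is → ⟦ VecAll.all? (i Fin.≟_) is ⟧ * ∏ᵗ x is) ≡ x i ^ r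
Σᵗ-diagonal zero    x i = refl
Σᵗ-diagonal (suc r) x i = begin
  sum (λ j → Σᵗ r λ is → ⟦ VecAll.all? (i Fin.≟_) (j ∷ is) ⟧ * (x j * ∏ᵗ x is))
    ≡⟨ sum-cong-≗ (λ j → trans (Σᵗ-cong r λ is → trans
         (cong (_* (x j * ∏ᵗ x is)) (⟦⟧-× VecAll._∷_ VecAll.uncons
           (i Fin.≟ j) (VecAll.all? (i Fin.≟_) is) (VecAll.all? (i Fin.≟_) (j ∷ is))))
         (regroup ⟦ i Fin.≟ j ⟧ ⟦ VecAll.all? (i Fin.≟_) is ⟧ (x j) (∏ᵗ x is)))
       (sym (*-distribˡ-Σᵗ r (⟦ i Fin.≟ j ⟧ * x j) (λ is → ⟦ VecAll.all? (i Fin.≟_) is ⟧ * ∏ᵗ x is)))) ⟩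
  sum (λ j → ⟦ i Fin.≟ j ⟧ * x j * Σᵗ r (λ is → ⟦ VecAll.all? (i Fin.≟_) is ⟧ * ∏ᵗ x is))
    ≡⟨ sum-cong-≗ (λ j → trans (cong (⟦ i Fin.≟ j ⟧ * x j *_) (Σᵗ-diagonal r x i))
         (ℚ.*-assoc ⟦ i Fin.≟ j ⟧ (x j) (x i ^ r))) ⟩
  sum (λ j → ⟦ i Fin.≟ j ⟧ * (x j * x i ^ r))
    ≡⟨ sum-⟦≟⟧ i (λ j → x j * x i ^ r) ⟩
  x i * x i ^ r ∎
  where
  open ≡-Reasoning
  regroup : ∀ a b c d → a * b * (c * d) ≡ a * c * (b * d)
  regroup = solve 4 (λ a b c d → a :* b :* (c :* d) := a :* c :* (b :* d)) refl

-- The signless Laplacian on rational vectors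

module _ {r n : ℕ} (G : Hypergraph (suc r) n) where
  open Hypergraph G

  weight : Vec (Fin n) (suc r) → ℚ
  weight is = (1ℤ / (r !)) {{r ℕ.!≢0}} * ⟦ setOf is ∈ₗ? edges ⟧

  -- The diagonal tensor is already collapsed here: among the tuples completing `i`, only the
  -- constant one contributes to it.
  evalQ : (Fin n → ℚ) → Fin n → ℚ
  evalQ x i = natℚ (degree G i) * x i ^ r + Σᵗ r λ is → weight (i ∷ is) * ∏ᵗ x is

  -- Each edge at `i` is completed by `r !` tuples, which cancels the normalisation `1/r!`.
  Σᵗ-weight : ∀ i → Σᵗ r (λ is → weight (i ∷ is)) ≡ natℚ (degree G i)
  Σᵗ-weight i = begin
    Σᵗ r (λ is → c * ⟦ setOf (i ∷ is) ∈ₗ? edges ⟧)  ≡⟨ *-distribˡ-Σᵗ r c (λ is → ⟦ setOf (i ∷ is) ∈ₗ? edges ⟧) ⟨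
    c * Σᵗ r (λ is → ⟦ setOf (i ∷ is) ∈ₗ? edges ⟧)  ≡⟨ cong (c *_) (Σᵗ-setOf-∷∈ r edges uniform unique i) ⟩
    c * (d * natℚ (r !))                            ≡⟨ x∙yz≈y∙xz c d (natℚ (r !)) ⟩
    d * (c * natℚ (r !))                            ≡⟨ cong (d *_) (1/d*d≡1 (r !) {{r ℕ.!≢0}}) ⟩
    d * 1ℚ                                          ≡⟨ ℚ.*-identityʳ d ⟩
    d                                               ∎
    where
    open ≡-Reasoning
    c d : ℚ
    c = (1ℤ / (r !)) {{r ℕ.!≢0}}
    d = natℚ (degree G i)

-- Termwise reduction from reals to rationals

seq-sum : ∀ {n} (f : Fin n → ℝ) N → seq (ℝ.sum f) N ≡ sum (λ i → seq (f i) N)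
seq-sum {zero}  f N = refl
seq-sum {suc n} f N = cong (seq (f zero) N +_) (seq-sum (λ i → f (suc i)) N)

seq-product : ∀ {n} (f : Fin n → ℝ) N → seq (ℝ.product f) N ≡ product (λ i → seq (f i) N)
seq-product {zero}  f N = refl
seq-product {suc n} f N = cong (seq (f zero) N *_) (seq-product (λ i → f (suc i)) N)

seq-sumTuples : ∀ {n} r (f : Vec (Fin n) r → ℝ) N → seq (sumTuples r f) N ≡ Σᵗ r (λ is → seq (f is) N)
seq-sumTuples zero    f N = refl
seq-sumTuples (suc r) f N = trans
  (seq-sum (λ i → sumTuples r λ is → f (i ∷ is)) N)
  (sum-cong-≗ λ i → seq-sumTuples r (λ is → f (i ∷ is)) N)

seq-if : ∀ {A : Set} (a? : Dec A) q N → seq (if ⌊ a? ⌋ then fromℚ q else 0ℝ) N ≡ q * ⟦ a? ⟧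
seq-if (yes _) q N = sym (ℚ.*-identityʳ q)
seq-if (no  _) q N = sym (ℚ.*-zeroʳ q)

-- Sums and products of reals act termwise, so this is an equality at every index and involves no
-- estimate.
seq-apply : ∀ {r n} (G : Hypergraph (suc r) n) (x : Fin n → ℝ) i N →
  seq (apply (signlessLaplacian G) x i) N ≡ evalQ G (λ j → seq (x j) N) i
seq-apply {r} G x i N = begin
  seq (apply (signlessLaplacian G) x i) N
    ≡⟨ seq-sumTuples r (λ is → signlessLaplacian G (i ∷ is) ℝ.* ℝ.product λ j → x (lookup is j)) N ⟩
  Σᵗ r (λ is → seq (signlessLaplacian G (i ∷ is)) N * seq (ℝ.product λ j → x (lookup is j)) N)
    ≡⟨ Σᵗ-cong r (λ is → cong₂ _*_
         (cong₂ _+_ (trans (seq-if (VecAll.all? (i Fin.≟_) is) ((ℤ.+ degree G i) / 1) N)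
                       (cong (_* ⟦ VecAll.all? (i Fin.≟_) is ⟧) (/1≡natℚ (degree G i))))
                    (seq-if (setOf (i ∷ is) ∈ₗ? Hypergraph.edges G) _ N))
         (seq-product (λ j → x (lookup is j)) N)) ⟩
  Σᵗ r (λ is → (d * δ is + weight G (i ∷ is)) * ∏ᵗ y is)
    ≡⟨ Σᵗ-cong r (λ is → expand d (δ is) (weight G (i ∷ is)) (∏ᵗ y is)) ⟩
  Σᵗ r (λ is → d * (δ is * ∏ᵗ y is) + weight G (i ∷ is) * ∏ᵗ y is)
    ≡⟨ Σᵗ-distrib-+ r (λ is → d * (δ is * ∏ᵗ y is)) (λ is → weight G (i ∷ is) * ∏ᵗ y is) ⟩
  Σᵗ r (λ is → d * (δ is * ∏ᵗ y is)) + Σᵗ r (λ is → weight G (i ∷ is) * ∏ᵗ y is)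
    ≡⟨ cong (_+ Σᵗ r (λ is → weight G (i ∷ is) * ∏ᵗ y is))
         (trans (sym (*-distribˡ-Σᵗ r d (λ is → δ is * ∏ᵗ y is))) (cong (d *_) (Σᵗ-diagonal r y i))) ⟩
  evalQ G y i ∎
  where
  open ≡-Reasoning
  y : Fin _ → ℚ
  y j = seq (x j) N
  d : ℚ
  d = natℚ (degree G i)
  δ : Vec (Fin _) r → ℚ
  δ is = ⟦ VecAll.all? (i Fin.≟_) is ⟧
  expand : ∀ a b c e → (a * b + c) * e ≡ a * (b * e) + c * e
  expand = solve 4 (λ a b c e → (a :* b :+ c) :* e := a :* (b :* e) :+ c :* e) refl

-- Signs

-- A power of `- 1ℚ`, so that products of signs become sums of exponents and sign conditions become
-- parity conditions.
sgn : ∀ {n} → Subset n → Fin n → ℚ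
sgn V j = (- 1ℚ) ^ bit V j

∏ᵗ-sgn : ∀ {n r} (V : Subset n) (is : Vec (Fin n) r) → ∏ᵗ (sgn V) is ≡ (- 1ℚ) ^ hits V is
∏ᵗ-sgn V []       = refl
∏ᵗ-sgn V (i ∷ is) = trans (cong (sgn V i *_) (∏ᵗ-sgn V is))
  (sym (^-homo-* (- 1ℚ) (bit V i) (hits V is)))

-1^even : ∀ {m} → 2 ∣ m → (- 1ℚ) ^ m ≡ 1ℚ
-1^even (divides zero    refl) = refl
-1^even (divides (suc q) refl) = begin
  (- 1ℚ) * ((- 1ℚ) * (- 1ℚ) ^ (q ℕ.* 2)) ≡⟨ ℚ.*-assoc (- 1ℚ) (- 1ℚ) ((- 1ℚ) ^ (q ℕ.* 2)) ⟨
  1ℚ * (- 1ℚ) ^ (q ℕ.* 2)                ≡⟨ ℚ.*-identityˡ ((- 1ℚ) ^ (q ℕ.* 2)) ⟩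
  (- 1ℚ) ^ (q ℕ.* 2)                     ≡⟨ -1^even (divides q refl) ⟩
  1ℚ                                     ∎
  where open ≡-Reasoning

sgn-^-* : ∀ {n r} (V : Subset n) (i : Fin n) (is : Vec (Fin n) r) →
  sgn V i ^ r * ∏ᵗ (sgn V) is ≡ (- 1ℚ) ^ (bit V i ℕ.* r ℕ.+ hits V is)
sgn-^-* {r = r} V i is = trans
  (cong₂ _*_ (^-assocʳ (- 1ℚ) (bit V i) r) (∏ᵗ-sgn V is))
  (sym (^-homo-* (- 1ℚ) (bit V i ℕ.* r) (hits V is)))

∣sgn∣≡1 : ∀ {n} (V : Subset n) j → ∣ sgn V j ∣ ≡ 1ℚ
∣sgn∣≡1 V j with lookup V j
... | true  = refl
... | false = refl

∣^∣≡1 : ∀ {p} r → ∣ p ∣ ≡ 1ℚ → ∣ p ^ r ∣ ≡ 1ℚ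
∣^∣≡1 zero    _ = refl
∣^∣≡1 {p} (suc r) h = trans (ℚ.∣p*q∣≡∣p∣*∣q∣ p (p ^ r)) (cong₂ _*_ h (∣^∣≡1 r h))

-- A zero coordinate counts as positive, so that `sgn-negatives` holds without exception.
negatives : ∀ {n} → (Fin n → ℚ) → Subset n
negatives y = Vec.tabulate λ j → ⌊ y j ℚ.<? 0ℚ ⌋

sgn-negatives : ∀ {n} (y : Fin n → ℚ) j → y j ≡ sgn (negatives y) j * ∣ y j ∣
sgn-negatives y j rewrite Vec.lookup∘tabulate (λ j → ⌊ y j ℚ.<? 0ℚ ⌋) j with y j ℚ.<? 0ℚ
... | yes y<0 = begin
  y j                     ≡⟨ neg-neg (y j) ⟩
  - 1ℚ * - y j            ≡⟨ cong (- 1ℚ *_) (ℚ.0≤p⇒∣p∣≡p (ℚ.neg-antimono-≤ (ℚ.<⇒≤ y<0))) ⟨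
  - 1ℚ * ∣ - y j ∣        ≡⟨ cong (- 1ℚ *_) (ℚ.∣-p∣≡∣p∣ (y j)) ⟩
  - 1ℚ * ∣ y j ∣          ∎
  where
  open ≡-Reasoning
  neg-neg : ∀ p → p ≡ - 1ℚ * - p
  neg-neg = solve 1 (λ p → p := con (- 1ℚ) :* :- p) refl
... | no  y≮0 = sym (trans (ℚ.*-identityˡ ∣ y j ∣) (ℚ.0≤p⇒∣p∣≡p (ℚ.≮⇒≥ y≮0)))

sgn*sgn : ∀ {n} (V : Subset n) j → sgn V j * sgn V j ≡ 1ℚ
sgn*sgn V j with lookup V j
... | true  = refl
... | false = refl

sgn*y≡∣y∣ : ∀ {n} (y : Fin n → ℚ) j → sgn (negatives y) j * y j ≡ ∣ y j ∣
sgn*y≡∣y∣ y j = begin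
  s * y j            ≡⟨ cong (s *_) (sgn-negatives y j) ⟩
  s * (s * ∣ y j ∣)  ≡⟨ ℚ.*-assoc s s ∣ y j ∣ ⟨
  s * s * ∣ y j ∣    ≡⟨ cong (_* ∣ y j ∣) (sgn*sgn (negatives y) j) ⟩
  1ℚ * ∣ y j ∣       ≡⟨ ℚ.*-identityˡ ∣ y j ∣ ⟩
  ∣ y j ∣            ∎
  where
  open ≡-Reasoning
  s : ℚ
  s = sgn (negatives y) j

-- Propagation of near-maximality along edges

module _ {r n : ℕ} (G : Hypergraph (suc r) n) where
  open Hypergraph G

  record NearKernel (top : Fin n) (y : Fin n → ℚ) (η : ℚ) : Set where
    field
      bounded : ∀ j → ∣ y j ∣ ≤ 1ℚ
      maximal : ∣ y top ∣ ≡ 1ℚ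
      small   : ∀ i → ∣ evalQ G y i ∣ ≤ η

  open NearKernel

  -- A sign `s` with `s * y i ^ r` equal to `∣ y i ∣ ^ r`; it stays a unit even where `y i`
  -- vanishes.
  signedRoot : (Fin n → ℚ) → Fin n → ℚ
  signedRoot y i = sgn (negatives y) i ^ r

  0≤weight : ∀ is → 0ℚ ≤ weight G is
  0≤weight is = *-nonNeg (0≤1/d (r !) {{r ℕ.!≢0}}) (0≤⟦⟧ (setOf is ∈ₗ? edges))
    where
    0≤1/d : ∀ d .{{_ : ℕ.NonZero d}} → 0ℚ ≤ 1ℤ / d
    0≤1/d d = ℚ.nonNegative⁻¹ (1ℤ / d) {{ℚ.normalize-nonNeg 1 d}}

  r!*weight : ∀ is → setOf is ∈ₗ edges → natℚ (r !) * weight G is ≡ 1ℚ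
  r!*weight is h = trans
    (cong (λ w → natℚ (r !) * (c * w)) (⟦⟧-⇔ (λ _ → h) (λ h → h) (setOf is ∈ₗ? edges) (yes h)))
    (trans (cong (natℚ (r !) *_) (ℚ.*-identityʳ c))
      (trans (ℚ.*-comm (natℚ (r !)) c) (1/d*d≡1 (r !) {{r ℕ.!≢0}})))
    where
    c : ℚ
    c = (1ℤ / (r !)) {{r ℕ.!≢0}}

  -- Adding 1 − s xᵢʳ turns each summand into 1 + s xᵢ₂⋯xᵢₖ, which is visibly
  -- nonnegative for |x| ≤ 1 and |s| = 1.
  evalQ-defect : ∀ y i s →
    Σᵗ r (λ is → weight G (i ∷ is) * (1ℚ + s * ∏ᵗ y is)) ≡
    s * evalQ G y i + natℚ (degree G i) * (1ℚ - s * y i ^ r)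
  evalQ-defect y i s = begin
    Σᵗ r (λ is → w is * (1ℚ + s * ∏ᵗ y is))
      ≡⟨ Σᵗ-cong r (λ is → expand (w is) s (∏ᵗ y is)) ⟩
    Σᵗ r (λ is → w is + s * (w is * ∏ᵗ y is))
      ≡⟨ Σᵗ-distrib-+ r w (λ is → s * (w is * ∏ᵗ y is)) ⟩
    Σᵗ r w + Σᵗ r (λ is → s * (w is * ∏ᵗ y is))
      ≡⟨ cong₂ _+_ (Σᵗ-weight G i) (sym (*-distribˡ-Σᵗ r s (λ is → w is * ∏ᵗ y is))) ⟩
    d + s * Σᵗ r (λ is → w is * ∏ᵗ y is)
      ≡⟨ collect d s (Σᵗ r (λ is → w is * ∏ᵗ y is)) (y i ^ r) ⟩
    s * evalQ G y i + d * (1ℚ - s * y i ^ r) ∎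
    where
    open ≡-Reasoning
    w : Vec (Fin n) r → ℚ
    w is = weight G (i ∷ is)
    d : ℚ
    d = natℚ (degree G i)
    expand : ∀ w s p → w * (1ℚ + s * p) ≡ w + s * (w * p)
    expand = solve 3 (λ w s p → w :* (con 1ℚ :+ s :* p) := w :+ s :* (w :* p)) refl
    collect : ∀ d s T a → d + s * T ≡ s * (d * a + T) + d * (1ℚ - s * a)
    collect = solve 4 (λ d s T a → d :+ s :* T := s :* (d :* a :+ T) :+ d :* (con 1ℚ :- s :* a)) refl

  -- Every summand in `evalQ-defect` is nonnegative, so the one for `is` is at most the whole sum;
  -- the factor `r !` undoes its weight. The sum is then bounded by the residual plus the loss
  -- `1 - ∣ y i ∣ ^ r`, which `1-^≤` controls.
  localBound : ∀ {top y η} → NearKernel top y η → ∀ i is → setOf (i ∷ is) ∈ₗ edges →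
    1ℚ + signedRoot y i * ∏ᵗ y is ≤ natℚ (r !) * (η + natℚ (degree G i) * (natℚ r * (1ℚ - ∣ y i ∣)))
  localBound {y = y} {η} near i is adj = begin
    1ℚ + s * ∏ᵗ y is
      ≡⟨ ℚ.*-identityˡ (1ℚ + s * ∏ᵗ y is) ⟨
    1ℚ * (1ℚ + s * ∏ᵗ y is)
      ≡⟨ cong (_* (1ℚ + s * ∏ᵗ y is)) (r!*weight (i ∷ is) adj) ⟨
    natℚ (r !) * weight G (i ∷ is) * (1ℚ + s * ∏ᵗ y is)
      ≡⟨ ℚ.*-assoc (natℚ (r !)) (weight G (i ∷ is)) (1ℚ + s * ∏ᵗ y is) ⟩
    natℚ (r !) * (weight G (i ∷ is) * (1ℚ + s * ∏ᵗ y is))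
      ≤⟨ *-monoˡ-≤ (natℚ (r !)) (0≤natℚ (r !)) (term≤Σᵗ r (λ is → weight G (i ∷ is) * (1ℚ + s * ∏ᵗ y is))
           (λ is → *-nonNeg (0≤weight (i ∷ is)) (0≤1+s∏ is)) is) ⟩
    natℚ (r !) * Σᵗ r (λ is → weight G (i ∷ is) * (1ℚ + s * ∏ᵗ y is))
      ≡⟨ cong (natℚ (r !) *_) (evalQ-defect y i s) ⟩
    natℚ (r !) * (s * evalQ G y i + d * (1ℚ - s * y i ^ r))
      ≡⟨ cong (λ a → natℚ (r !) * (s * evalQ G y i + d * (1ℚ - a))) s*y^r ⟩
    natℚ (r !) * (s * evalQ G y i + d * (1ℚ - ∣ y i ∣ ^ r))
      ≤⟨ *-monoˡ-≤ (natℚ (r !)) (0≤natℚ (r !)) (ℚ.+-mono-≤ s*Q≤η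
           (*-monoˡ-≤ d (0≤natℚ (degree G i)) (1-^≤ r (ℚ.0≤∣p∣ (y i)) (bounded near i)))) ⟩
    natℚ (r !) * (η + d * (natℚ r * (1ℚ - ∣ y i ∣))) ∎
    where
    open ℚ.≤-Reasoning
    s d : ℚ
    s = signedRoot y i
    d = natℚ (degree G i)
    ∣s∣≡1 : ∣ s ∣ ≡ 1ℚ
    ∣s∣≡1 = ∣^∣≡1 r (∣sgn∣≡1 (negatives y) i)
    ∣s*p∣≡∣p∣ : ∀ p → ∣ s * p ∣ ≡ ∣ p ∣
    ∣s*p∣≡∣p∣ p = trans (ℚ.∣p*q∣≡∣p∣*∣q∣ s p) (trans (cong (_* ∣ p ∣) ∣s∣≡1) (ℚ.*-identityˡ ∣ p ∣))
    s*Q≤η : s * evalQ G y i ≤ η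
    s*Q≤η = ℚ.≤-trans (p≤∣p∣ (s * evalQ G y i))
      (subst (_≤ η) (sym (∣s*p∣≡∣p∣ (evalQ G y i))) (small near i))
    s*y^r : s * y i ^ r ≡ ∣ y i ∣ ^ r
    s*y^r = trans (sym (^-distrib-* (sgn (negatives y) i) (y i) r)) (cong (_^ r) (sgn*y≡∣y∣ y i))
    0≤1+s∏ : ∀ is → 0ℚ ≤ 1ℚ + s * ∏ᵗ y is
    0≤1+s∏ is = subst (0ℚ ≤_) (minus-neg (s * ∏ᵗ y is)) (p≤q⇒0≤q-p (- (s * ∏ᵗ y is)) 1ℚ
      (ℚ.≤-trans (-p≤∣p∣ (s * ∏ᵗ y is))
        (subst (_≤ 1ℚ) (sym (trans (∣s*p∣≡∣p∣ (∏ᵗ y is)) (∣∏ᵗ∣ y is)))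
          (∏ᵗ≤1 (λ j → ℚ.0≤∣p∣ (y j)) (bounded near) is))))
      where
      minus-neg : ∀ p → 1ℚ - (- p) ≡ 1ℚ + p
      minus-neg = solve 1 (λ p → con 1ℚ :- (:- p) := con 1ℚ :+ p) refl

  -- With all coordinates at most 1 in size, a product is no larger than any of its factors; hence a
  -- product close to minus the sign forces each factor close to size 1.
  defect≤ : ∀ {top y η} → NearKernel top y η → ∀ i (is : Vec (Fin n) r) t →
    1ℚ - ∣ y (lookup is t) ∣ ≤ 1ℚ + signedRoot y i * ∏ᵗ y is
  defect≤ {y = y} near i is t = ℚ.+-monoʳ-≤ 1ℚ (begin
    - ∣ y (lookup is t) ∣   ≤⟨ ℚ.neg-antimono-≤ (∏ᵗ≤factor (λ j → ℚ.0≤∣p∣ (y j)) (bounded near) is t) ⟩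
    - ∏ᵗ (λ j → ∣ y j ∣) is ≡⟨ cong -_ (trans (sym (∣∏ᵗ∣ y is)) (sym ∣s*∏∣)) ⟩
    - ∣ s * ∏ᵗ y is ∣       ≤⟨ ℚ.neg-antimono-≤ (-p≤∣p∣ (s * ∏ᵗ y is)) ⟩
    - - (s * ∏ᵗ y is)       ≡⟨ neg-neg (s * ∏ᵗ y is) ⟩
    s * ∏ᵗ y is             ∎)
    where
    open ℚ.≤-Reasoning
    s : ℚ
    s = signedRoot y i
    ∣s*∏∣ : ∣ s * ∏ᵗ y is ∣ ≡ ∣ ∏ᵗ y is ∣
    ∣s*∏∣ = trans (ℚ.∣p*q∣≡∣p∣*∣q∣ s (∏ᵗ y is))
      (trans (cong (_* ∣ ∏ᵗ y is ∣) (∣^∣≡1 r (∣sgn∣≡1 (negatives y) i))) (ℚ.*-identityˡ ∣ ∏ᵗ y is ∣))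
    neg-neg : ∀ p → - - p ≡ p
    neg-neg = solve 1 (λ p → :- (:- p) := p) refl

  -- C is independent of y and η, hence survives the choice of η at the end.
  LinearlyClose : Fin n → Fin n → Set
  LinearlyClose top v = ∃ λ C → ∀ {y η} → NearKernel top y η → 1ℚ - ∣ y v ∣ ≤ C * η

  -- What `localBound` gives once `1 - ∣ y i ∣` is replaced by `C * η` and `η` is factored out.
  edgeConstant : Fin n → ℚ → ℚ
  edgeConstant i C = natℚ (r !) * (1ℚ + natℚ (degree G i) * (natℚ r * C))

  edgeBound : ∀ {top i} ((C , _) : LinearlyClose top i) → ∀ {y η} → NearKernel top y η →
    ∀ is → setOf (i ∷ is) ∈ₗ edges → 1ℚ + signedRoot y i * ∏ᵗ y is ≤ edgeConstant i C * η
  edgeBound {i = i} (C , close) {y} {η} near is adj = begin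
    1ℚ + signedRoot y i * ∏ᵗ y is
      ≤⟨ localBound near i is adj ⟩
    natℚ (r !) * (η + d * (natℚ r * (1ℚ - ∣ y i ∣)))
      ≤⟨ *-monoˡ-≤ (natℚ (r !)) (0≤natℚ (r !)) (ℚ.+-monoʳ-≤ η
           (*-monoˡ-≤ d (0≤natℚ (degree G i)) (*-monoˡ-≤ (natℚ r) (0≤natℚ r) (close near)))) ⟩
    natℚ (r !) * (η + d * (natℚ r * (C * η)))
      ≡⟨ factor (natℚ (r !)) η d (natℚ r) C ⟩
    edgeConstant i C * η ∎
    where
    open ℚ.≤-Reasoning
    d : ℚ
    d = natℚ (degree G i)
    factor : ∀ a η d m C → a * (η + d * (m * (C * η))) ≡ a * (1ℚ + d * (m * C)) * η
    factor = solve 5 (λ a η d m C → a :* (η :+ d :* (m :* (C :* η))) := a :* (con 1ℚ :+ d :* (m :* C)) :* η) refl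

  close-refl : ∀ top → LinearlyClose top top
  close-refl top = 0ℚ , λ {_} {η} near → ℚ.≤-reflexive
    (trans (cong (_-_ 1ℚ) (maximal near)) (sym (ℚ.*-zeroˡ η)))

  -- With the edge listed from `u`, the vertex `v` is either `u` itself, which keeps its constant,
  -- or a factor of the product in row `u`, where `defect≤` and `edgeBound` apply.
  close-edge : ∀ {top e u v} → e ∈ₗ edges → u ∈ e → v ∈ e → LinearlyClose top u → LinearlyClose top v
  close-edge {e = e} {u} e∈E u∈e v∈e close
    with enumerateFrom (All.lookup uniform e∈E) u∈e
  ... | is , refl with ∈setOf⇒lookup (u ∷ is) v∈e
  ...   | zero  , refl = close
  ...   | suc t , refl = edgeConstant u (proj₁ close) ,
    λ near → ℚ.≤-trans (defect≤ near u is t) (edgeBound close near is e∈E)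

  -- Consecutive edges share a vertex; it is close as a member of the first edge, and closeness
  -- spreads from it over the second.
  close-walk : ∀ {top e f} → Star (Meets G) e f → (∀ {v} → v ∈ proj₁ e → LinearlyClose top v) →
    ∀ {v} → v ∈ proj₁ f → LinearlyClose top v
  close-walk ε close = close
  close-walk {e = e , _} (_◅_ {j = f , f∈E} (u , u∈e∩f) walk) close =
    let u∈e , u∈f = x∈p∩q⁻ e f u∈e∩f
    in close-walk walk λ v∈f → close-edge f∈E u∈f v∈f (close u∈e)

  close-connected : Connected G → ∀ top v → LinearlyClose top v
  close-connected connected top v with top Fin.≟ v
  ... | yes refl   = close-refl top
  ... | no  top≢v =
    let (e , e∈E) , _ , top∈e , v∈f , walk = connected top v top≢v
    in close-walk walk (λ u∈e → close-edge e∈E top∈e u∈e (close-refl top)) v∈f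

  module _ (connected : Connected G) where

    constant : Fin n → Fin n → ℚ
    constant top i = edgeConstant i (proj₁ (close-connected connected top i))

    rowSum : Fin n → ℚ
    rowSum top = sum λ i → ∣ constant top i ∣

    -- Dominates `constant top i` for all pairs at once, because the maximal coordinate is not yet
    -- known when `η` is chosen. The summand `1ℚ` makes it positive, so that it can be divided by.
    uniformConstant : ℚ
    uniformConstant = 1ℚ + sum rowSum

    0≤rowSum : ∀ top → 0ℚ ≤ rowSum top
    0≤rowSum top = sum-nonNeg (λ i → ∣ constant top i ∣) λ i → ℚ.0≤∣p∣ (constant top i)

    0<uniformConstant : 0ℚ < uniformConstant
    0<uniformConstant = ℚ.+-mono-<-≤ (ℚ.positive⁻¹ 1ℚ) (sum-nonNeg rowSum 0≤rowSum)

    constant≤ : ∀ top i → constant top i ≤ uniformConstant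
    constant≤ top i = begin
      constant top i      ≤⟨ p≤∣p∣ (constant top i) ⟩
      ∣ constant top i ∣  ≤⟨ term≤sum (λ i → ∣ constant top i ∣) (λ i → ℚ.0≤∣p∣ (constant top i)) i ⟩
      rowSum top          ≤⟨ term≤sum rowSum 0≤rowSum top ⟩
      sum rowSum          ≡⟨ ℚ.+-identityˡ (sum rowSum) ⟨
      0ℚ + sum rowSum     ≤⟨ ℚ.+-monoˡ-≤ (sum rowSum) 0≤1 ⟩
      uniformConstant     ∎
      where open ℚ.≤-Reasoning

  -- For k = 1 + r the exponent parity says that the sign vector x of V satisfies
  -- xᵢʳ xᵢ₂⋯xᵢₖ = −1 on every edge, so that xᵢʳ + xᵢ₂⋯xᵢₖ = 0 there.
  OddSigns : Subset n → Set
  OddSigns V = ∀ i (is : Vec (Fin n) r) → setOf (i ∷ is) ∈ₗ edges → 2 ∤ bit V i ℕ.* r ℕ.+ hits V is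

  nearKernel⇒oddSigns : Connected G →
    ∃ λ η → 0ℚ < η × (∀ {top y} → NearKernel top y η → OddSigns (negatives y))
  nearKernel⇒oddSigns connected =
    -- This `η` makes the uniform bound equal to `½`. An even exponent would cancel all signs and
    -- leave `1 ≤ 1 + ∏ ∣ y j ∣ ≤ ½`.
    let η , 0<η , Kη≡½ = divide (uniformConstant connected) ½
                        (0<uniformConstant connected) (ℚ.positive⁻¹ ½)
    in η , 0<η , λ {top} {y} near i is adj even →
      let K = constant connected top i
          open ℚ.≤-Reasoning
      in ℚ.<-irrefl refl (begin-strict
        1ℚ                                   ≡⟨ ℚ.+-identityʳ 1ℚ ⟨
        1ℚ + 0ℚ                              ≤⟨ ℚ.+-monoʳ-≤ 1ℚ (∏ᵗ-nonNeg (λ j → ℚ.0≤∣p∣ (y j)) is) ⟩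
        1ℚ + ∏ᵗ (λ j → ∣ y j ∣) is           ≡⟨ cong (1ℚ +_) (sym (s∏≡ y i is even)) ⟩
        1ℚ + signedRoot y i * ∏ᵗ y is        ≤⟨ edgeBound (close-connected connected top i) near is adj ⟩
        K * η                                ≤⟨ *-monoʳ-≤ η (ℚ.<⇒≤ 0<η) (constant≤ connected top i) ⟩
        uniformConstant connected * η        ≡⟨ Kη≡½ ⟩
        ½                                    <⟨ ½<1 ⟩
        1ℚ                                   ∎)
    where
    ½<1 : ½ < 1ℚ
    ½<1 = from-yes (½ ℚ.<? 1ℚ)
    s∏≡ : ∀ y i (is : Vec (Fin n) r) → 2 ∣ bit (negatives y) i ℕ.* r ℕ.+ hits (negatives y) is →
      signedRoot y i * ∏ᵗ y is ≡ ∏ᵗ (λ j → ∣ y j ∣) is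
    s∏≡ y i is even = begin
      s * ∏ᵗ y is                                 ≡⟨ cong (s *_) (∏ᵗ-cong (sgn-negatives y) is) ⟩
      s * ∏ᵗ (λ j → sgn V j * ∣ y j ∣) is         ≡⟨ cong (s *_) (∏ᵗ-distrib-* (sgn V) (λ j → ∣ y j ∣) is) ⟩
      s * (∏ᵗ (sgn V) is * ∏ᵗ (λ j → ∣ y j ∣) is) ≡⟨ ℚ.*-assoc s (∏ᵗ (sgn V) is) (∏ᵗ (λ j → ∣ y j ∣) is) ⟨
      s * ∏ᵗ (sgn V) is * ∏ᵗ (λ j → ∣ y j ∣) is   ≡⟨ cong (_* ∏ᵗ (λ j → ∣ y j ∣) is) (trans (sgn-^-* V i is) (-1^even even)) ⟩
      1ℚ * ∏ᵗ (λ j → ∣ y j ∣) is                  ≡⟨ ℚ.*-identityˡ (∏ᵗ (λ j → ∣ y j ∣) is) ⟩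
      ∏ᵗ (λ j → ∣ y j ∣) is                       ∎
      where
      open ≡-Reasoning
      V : Subset n
      V = negatives y
      s : ℚ
      s = signedRoot y i
      ∏ᵗ-cong : ∀ {r} {x z : Fin n → ℚ} → (∀ j → x j ≡ z j) → (is : Vec (Fin n) r) → ∏ᵗ x is ≡ ∏ᵗ z is
      ∏ᵗ-cong x≡z []       = refl
      ∏ᵗ-cong x≡z (i ∷ is) = cong₂ _*_ (x≡z i) (∏ᵗ-cong x≡z is)

-- Parity

2∣m⊎2∣1+m : ∀ m → (2 ∣ m) ⊎ (2 ∣ suc m)
2∣m⊎2∣1+m zero    = inj₁ (2 ∣0)
2∣m⊎2∣1+m (suc m) with 2∣m⊎2∣1+m m
... | inj₁ 2∣m   = inj₂ (∣m∣n⇒∣m+n (divides 1 refl) 2∣m)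
... | inj₂ 2∣1+m = inj₁ 2∣1+m

2∤m⇒2∣1+m : ∀ {m} → 2 ∤ m → 2 ∣ suc m
2∤m⇒2∣1+m {m} 2∤m with 2∣m⊎2∣1+m m
... | inj₁ 2∣m   = contradiction 2∣m 2∤m
... | inj₂ 2∣1+m = 2∣1+m

2∤1+m⇒2∣m : ∀ {m} → 2 ∤ suc m → 2 ∣ m
2∤1+m⇒2∣m {m} 2∤1+m with 2∣m⊎2∣1+m m
... | inj₁ 2∣m   = 2∣m
... | inj₂ 2∣1+m = contradiction 2∣1+m 2∤1+m

2∣m⇒2∤1+m : ∀ {m} → 2 ∣ m → 2 ∤ suc m
2∣m⇒2∤1+m {m} 2∣m 2∣1+m with ∣m+n∣m⇒∣n (subst (2 ∣_) (ℕ.+-comm 1 m) 2∣1+m) 2∣m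
... | divides zero    ()
... | divides (suc _) ()

bit-∈ : ∀ {n} {V : Subset n} {i} → i ∈ V → bit V i ≡ 1
bit-∈ i∈V = cong (if_then 1 else 0) (Vec.[]=⇒lookup i∈V)

bit-∉ : ∀ {n} {V : Subset n} {i} → i ∉ V → bit V i ≡ 0
bit-∉ {V = V} {i} i∉V with lookup V i in eq
... | true  = contradiction (Vec.lookup⇒[]= i V eq) i∉V
... | false = refl

-- Odd signs and odd-bipartiteness

module _ {r n : ℕ} (G : Hypergraph (suc r) n) where
  open Hypergraph G

  OddTransversal : Subset n → Set
  OddTransversal V = ∀ e → e ∈ₗ edges → 2 ∤ ∣ e ∩ V ∣ˢ

  ∣setOf∩V∣≡ : ∀ V i (is : Vec (Fin n) r) → setOf (i ∷ is) ∈ₗ edges →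
    ∣ setOf (i ∷ is) ∩ V ∣ˢ ≡ bit V i ℕ.+ hits V is
  ∣setOf∩V∣≡ V i is adj = ∣setOf∩V∣≡hits V (i ∷ is) (All.lookup uniform adj)

  -- For `i` outside `V` the exponent is the size of the intersection. For `i` in `V` that size is
  -- `1 + hits V is`, so `hits V is` is even, while `r` is odd because `k` is even; the exponent is
  -- their sum.
  oddTransversal⇒oddSigns : ∀ V → 2 ∣ suc r → OddTransversal V → OddSigns G V
  oddTransversal⇒oddSigns V 2∣k odd i is adj even
    with i ∈? V | odd _ adj | ∣setOf∩V∣≡ V i is adj
  ... | no  i∉V | 2∤ν | ν≡ rewrite ν≡ | bit-∉ i∉V = 2∤ν even
  ... | yes i∈V | 2∤ν | ν≡ rewrite ν≡ | bit-∈ i∈V | ℕ.*-identityˡ r = 2∣m⇒2∤1+m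
    (∣m+n∣m⇒∣n (subst (2 ∣_) (ℕ.+-comm r (hits V is)) even) (2∤1+m⇒2∣m 2∤ν)) 2∣k

  module _ (V : Subset n) (odd : OddSigns G V) where

    -- With the edge listed from a vertex outside `V`, the exponent is exactly the size of the
    -- intersection.
    oddSigns-∉ : ∀ {e i} → e ∈ₗ edges → i ∈ e → i ∉ V → 2 ∤ ∣ e ∩ V ∣ˢ
    oddSigns-∉ e∈E i∈e i∉V 2∣ν with enumerateFrom (All.lookup uniform e∈E) i∈e
    ... | is , refl with odd _ is e∈E | ∣setOf∩V∣≡ V _ is e∈E
    ...   | 2∤N | ν≡ rewrite ν≡ | bit-∉ i∉V = 2∤N 2∣ν

    oddSigns-∈ : ∀ {e i} → e ∈ₗ edges → i ∈ e → i ∈ V →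
      ∃ λ h → 2 ∤ r ℕ.+ h × ∣ e ∩ V ∣ˢ ≡ suc h
    oddSigns-∈ e∈E i∈e i∈V with enumerateFrom (All.lookup uniform e∈E) i∈e
    ... | is , refl with odd _ is e∈E | ∣setOf∩V∣≡ V _ is e∈E
    ...   | 2∤N | ν≡ rewrite bit-∈ i∈V | ℕ.*-identityˡ r = hits V is , 2∤N , ν≡

    oddSigns⇒oddTransversal : 2 ∣ suc r → OddTransversal V
    oddSigns⇒oddTransversal 2∣k e e∈E
      with ∣p∣≡suc⇒Nonempty e (All.lookup uniform e∈E)
    ... | i , i∈e with i ∈? V
    ...   | no i∉V = oddSigns-∉ e∈E i∈e i∉V
    ...   | yes i∈V with oddSigns-∈ e∈E i∈e i∈V
    -- Here `k + ∣ e ∩ V ∣` equals `2 + (r + h)`; as `k` is even, the intersection size and `r + h`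
    -- have the same parity.
    ...     | h , 2∤r+h , ν≡1+h rewrite ν≡1+h = λ 2∣1+h → 2∤r+h (∣m+n∣m⇒∣n
      (subst (2 ∣_) (cong suc (ℕ.+-suc r h)) (∣m∣n⇒∣m+n 2∣k 2∣1+h)) (divides 1 refl))

    ∣e∩V∣≡k : ∀ {e} → e ∈ₗ edges → (∀ {i} → i ∈ e → i ∈ V) → ∣ e ∩ V ∣ˢ ≡ suc r
    ∣e∩V∣≡k {e} e∈E e⊆V = trans
      (cong ∣_∣ˢ (⊆-antisym (p∩q⊆p e V) λ i∈e → x∈p∩q⁺ (i∈e , e⊆V i∈e)))
      (All.lookup uniform e∈E)

    -- For odd k an edge meeting V would meet it in an even number of vertices
    -- and an edge leaving V in an odd number.
    oddSigns⇒2∣k : ∀ {e} → e ∈ₗ edges → 2 ∣ suc r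
    oddSigns⇒2∣k {e} e∈E = decidable-stable (2 ∣? suc r) λ 2∤k →
      -- Were the intersection size even, `oddSigns-∉` would put every vertex of `e` in `V`, and the
      -- size would be `k`, against `2∤k`.
      let 2∤ν = λ 2∣ν → 2∤k (subst (2 ∣_)
                  (∣e∩V∣≡k e∈E λ {i} i∈e → decidable-stable (i ∈? V) λ i∉V → oddSigns-∉ e∈E i∈e i∉V 2∣ν)
                  2∣ν)
          i , i∈e∩V = nonempty 2∤ν
          i∈e , i∈V = x∈p∩q⁻ e V i∈e∩V
          h , 2∤r+h , ν≡1+h = oddSigns-∈ e∈E i∈e i∈V
      in 2∤ν (subst (2 ∣_) (sym ν≡1+h) (2∤m⇒2∣1+m λ 2∣h → 2∤r+h (∣m∣n⇒∣m+n (2∤1+m⇒2∣m 2∤k) 2∣h)))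
      where
      nonempty : 2 ∤ ∣ e ∩ V ∣ˢ → ∃ λ i → i ∈ e ∩ V
      nonempty 2∤ν with ∣ e ∩ V ∣ˢ in eq
      ... | zero  = contradiction (2 ∣0) 2∤ν
      ... | suc _ = ∣p∣≡suc⇒Nonempty (e ∩ V) eq

    -- If `V` were everything, the edge would meet it in all of its `k` vertices, an even number.
    oddSigns⇒⊂⊤ : ∀ {e} → e ∈ₗ edges → V ⊂ ⊤
    oddSigns⇒⊂⊤ {e} e∈E =
      let v , v∉V = Fin.¬∀⟶∃¬ n (_∈ V) (_∈? V) λ ⊤⊆V → oddSigns⇒oddTransversal 2∣k e e∈E
                      (subst (2 ∣_) (sym (∣e∩V∣≡k e∈E λ {i} _ → ⊤⊆V i)) 2∣k)
      in ⊆⊤ , v , ∈⊤ , v∉V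
      where
      2∣k : 2 ∣ suc r
      2∣k = oddSigns⇒2∣k e∈E

    oddSigns⇒oddBipartite : edges ≢ [] → 2 ∣ suc r × OddBipartite G
    oddSigns⇒oddBipartite edges≢[] =
      let e , e∈E = someEdge in
      oddSigns⇒2∣k e∈E , oddSigns⇒2∣k e∈E , V , oddSigns⇒⊂⊤ e∈E , oddSigns⇒oddTransversal (oddSigns⇒2∣k e∈E)
      where
      someEdge : ∃ λ e → e ∈ₗ edges
      someEdge with edges
      ... | []    = contradiction refl edges≢[]
      ... | e ∷ _ = e , here refl

  oddBipartite? : Dec (2 ∣ suc r × OddBipartite G)
  oddBipartite? = (2 ∣? suc r) ×-dec (2 ∣? suc r) ×-dec anySubset? λ V →
    (V ⊂? ⊤) ×-dec map′ (λ all e e∈E → All.lookup all e∈E) (λ odd → All.tabulate λ {e} → odd e)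
      (All.all? (λ e → ¬? (2 ∣? ∣ e ∩ V ∣ˢ)) edges)

  -- Homogeneity and normalisation

  evalQ-scale : ∀ t x i → evalQ G (λ j → t * x j) i ≡ t ^ r * evalQ G x i
  evalQ-scale t x i = begin
    d * (t * x i) ^ r + Σᵗ r (λ is → w is * ∏ᵗ (λ j → t * x j) is)
      ≡⟨ cong₂ _+_ (cong (d *_) (^-distrib-* t (x i) r)) (Σᵗ-cong r λ is → trans
           (cong (w is *_) (trans (∏ᵗ-distrib-* (λ _ → t) x is) (cong (_* ∏ᵗ x is) (∏ᵗ-const t is))))
           (x∙yz≈y∙xz (w is) (t ^ r) (∏ᵗ x is))) ⟩
    d * (t ^ r * x i ^ r) + Σᵗ r (λ is → t ^ r * (w is * ∏ᵗ x is))
      ≡⟨ cong₂ _+_ (x∙yz≈y∙xz d (t ^ r) (x i ^ r)) (sym (*-distribˡ-Σᵗ r (t ^ r) (λ is → w is * ∏ᵗ x is))) ⟩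
    t ^ r * (d * x i ^ r) + t ^ r * Σᵗ r (λ is → w is * ∏ᵗ x is)
      ≡⟨ ℚ.*-distribˡ-+ (t ^ r) (d * x i ^ r) (Σᵗ r (λ is → w is * ∏ᵗ x is)) ⟨
    t ^ r * evalQ G x i ∎
    where
    open ≡-Reasoning
    w : Vec (Fin n) r → ℚ
    w is = weight G (i ∷ is)
    d : ℚ
    d = natℚ (degree G i)

  -- A vector with a coordinate of size at least δ and a residual below η δʳ
  -- normalises to an approximate kernel vector, so it already yields odd signs.
  largeCoordinate⇒oddSigns : Connected G → ∀ δ → 0ℚ < δ →
    ∃ λ κ → 0ℚ < κ × (∀ x → (∀ i → ∣ evalQ G x i ∣ ≤ κ) → ∀ i → δ ≤ ∣ x i ∣ → ∃ (OddSigns G))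
  largeCoordinate⇒oddSigns connected δ 0<δ =
    let η , 0<η , good = nearKernel⇒oddSigns G connected
    in η * δ ^ r , *-pos 0<η (^-pos r 0<δ) , λ x small i δ≤∣xi∣ →
      let a = λ j → ∣ x j ∣
          -- `argmax` takes a default value for the empty list; the given index `i` serves.
          top = argmax a i (allFin n)
          a≤ = λ j → All.lookup (f[xs]≤f[argmax] {f = a} i (allFin n)) (∈-allFin j)
          δ≤a = ℚ.≤-trans δ≤∣xi∣ (a≤ i)
          -- The scale `t` is the inverse of the largest absolute value, which is at least `δ` and
          -- so nonzero.
          t , 0<t , at≡1 = divide (a top) 1ℚ (ℚ.<-≤-trans 0<δ δ≤a) (ℚ.positive⁻¹ 1ℚ)
          ta≡1 = trans (ℚ.*-comm t (a top)) at≡1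
      in negatives (λ j → t * x j) , good {top} {λ j → t * x j} record
        { bounded = λ j → subst₂ _≤_ (sym (∣t*p∣ t (x j) 0<t)) ta≡1 (*-monoˡ-≤ t (ℚ.<⇒≤ 0<t) (a≤ j))
        ; maximal = trans (∣t*p∣ t (x top) 0<t) ta≡1
        -- From `δ ≤ a top` comes `t * δ ≤ 1`. The residual scales by `t ^ r`, so a bound of
        -- `η * δ ^ r` becomes at most `η`.
        ; small   = λ j → scaled t x 0<t η (ℚ.<⇒≤ 0<η)
            (subst (t * δ ≤_) ta≡1 (*-monoˡ-≤ t (ℚ.<⇒≤ 0<t) δ≤a)) j (small j)
        }
    where
    *-pos : ∀ {p q} → 0ℚ < p → 0ℚ < q → 0ℚ < p * q
    *-pos {p} {q} 0<p 0<q = ℚ.positive⁻¹ (p * q) {{ℚ.pos*pos⇒pos p {{positive 0<p}} q {{positive 0<q}}}}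
    ^-pos : ∀ {p} r → 0ℚ < p → 0ℚ < p ^ r
    ^-pos zero    0<p = ℚ.positive⁻¹ 1ℚ
    ^-pos (suc r) 0<p = *-pos 0<p (^-pos r 0<p)
    ∣t*p∣ : ∀ t p → 0ℚ < t → ∣ t * p ∣ ≡ t * ∣ p ∣
    ∣t*p∣ t p 0<t = trans (ℚ.∣p*q∣≡∣p∣*∣q∣ t p) (cong (_* ∣ p ∣) (ℚ.0≤p⇒∣p∣≡p (ℚ.<⇒≤ 0<t)))
    scaled : ∀ t x → 0ℚ < t → ∀ η → 0ℚ ≤ η → t * δ ≤ 1ℚ → ∀ j → ∣ evalQ G x j ∣ ≤ η * δ ^ r →
      ∣ evalQ G (λ j → t * x j) j ∣ ≤ η
    scaled t x 0<t η 0≤η tδ≤1 j h = begin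
      ∣ evalQ G (λ j → t * x j) j ∣   ≡⟨ cong ∣_∣ (evalQ-scale t x j) ⟩
      ∣ t ^ r * evalQ G x j ∣         ≡⟨ ∣t*p∣ (t ^ r) (evalQ G x j) (^-pos r 0<t) ⟩
      t ^ r * ∣ evalQ G x j ∣         ≤⟨ *-monoˡ-≤ (t ^ r) (^-nonNeg r (ℚ.<⇒≤ 0<t)) h ⟩
      t ^ r * (η * δ ^ r)             ≡⟨ x∙yz≈y∙xz (t ^ r) η (δ ^ r) ⟩
      η * (t ^ r * δ ^ r)             ≡⟨ cong (η *_) (^-distrib-* t δ r) ⟨
      η * (t * δ) ^ r                 ≤⟨ p*q≤p η 0≤η (^≤1 r (*-nonNeg (ℚ.<⇒≤ 0<t) (ℚ.<⇒≤ 0<δ)) tδ≤1) ⟩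
      η                               ∎
      where open ℚ.≤-Reasoning

-- From a real kernel vector to an odd bipartition

eventually-all : ∀ {n} {P : Fin n → ℕ → Set} → (∀ i → ∃ λ N → ∀ m → N ℕ.≤ m → P i m) →
  ∃ λ N → ∀ m → N ℕ.≤ m → ∀ i → P i m
eventually-all {zero}  h = 0 , λ _ _ ()
eventually-all {suc n} h =
  let N₀ , h₀ = h zero
      N₁ , h₁ = eventually-all (λ i → h (suc i))
  in N₀ ℕ.⊔ N₁ , λ m N≤m → λ
    { zero    → h₀ m (ℕ.m⊔n≤o⇒m≤o N₀ N₁ N≤m)
    ; (suc i) → h₁ m (ℕ.m⊔n≤o⇒n≤o N₀ N₁ N≤m) i
    }

hEigenvalue⇒oddBipartite : ∀ {r n} (G : Hypergraph (suc r) n) → Connected G → Hypergraph.edges G ≢ [] →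
  IsHEigenvalue (signlessLaplacian G) 0ℝ → 2 ∣ suc r × OddBipartite G
hEigenvalue⇒oddBipartite {r} {n} G connected edges≢[] (x , x≉0 , Qx≈0) =
  decidable-stable (oddBipartite? G) λ ¬D → x≉0 λ i δ 0<δ →
    -- `κ` depends on `δ` alone, so `N` is fixed before the index `m`; the largest coordinate and
    -- the sign set may vary with `m`.
    let κ , 0<κ , good = largeCoordinate⇒oddSigns G connected δ 0<δ
        N , small      = eventually-all (λ j → Qx≈0 j κ 0<κ)
    in N , λ m N≤m → ℚ.≰⇒> λ δ≤ →
      let V , odd = good (λ j → seq (x j) m)
            (λ j → ℚ.<⇒≤ (subst (λ q → ∣ q ∣ < κ) (residual j m) (small m N≤m j)))
            i (subst (λ q → δ ≤ ∣ q ∣) (ℚ.+-identityʳ (seq (x i) m)) δ≤)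
      in ¬D (oddSigns⇒oddBipartite G V odd edges≢[])
  where
  residual : ∀ j m → seq (apply (signlessLaplacian G) x j) m - 0ℚ * seq (x j ℝ.^ r) m ≡
                     evalQ G (λ j → seq (x j) m) j
  residual j m = trans
    (cong₂ _-_ (seq-apply G x j m) (ℚ.*-zeroˡ (seq (x j ℝ.^ r) m)))
    (ℚ.+-identityʳ (evalQ G (λ j → seq (x j) m) j))

-- The sign vector as an exact kernel vector

-1^odd : ∀ {m} → 2 ∤ m → (- 1ℚ) ^ m ≡ - 1ℚ
-1^odd {zero}  2∤m = contradiction (2 ∣0) 2∤m
-1^odd {suc m} 2∤m = cong (- 1ℚ *_) (-1^even (2∤1+m⇒2∣m 2∤m))

-- On tuples completing `i` to an edge the product is `- s` with `s = sgn V i ^ r`, and all other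
-- weights vanish. The weights of the row sum to the degree, so the two parts of `evalQ` cancel.
oddSigns⇒kernel : ∀ {r n} (G : Hypergraph (suc r) n) V → OddSigns G V → ∀ i → evalQ G (sgn V) i ≡ 0ℚ
oddSigns⇒kernel {r} {n} G V odd i = begin
  d * s + Σᵗ r (λ is → w is * ∏ᵗ (sgn V) is)    ≡⟨ cong (d * s +_) (Σᵗ-cong r term) ⟩
  d * s + Σᵗ r (λ is → - s * w is)              ≡⟨ cong (d * s +_) (*-distribˡ-Σᵗ r (- s) w) ⟨
  d * s + - s * Σᵗ r w                          ≡⟨ cong (λ z → d * s + - s * z) (Σᵗ-weight G i) ⟩
  d * s + - s * d                               ≡⟨ cancel d s ⟩
  0ℚ                                            ∎
  where
  open ≡-Reasoning
  w : Vec (Fin n) r → ℚ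
  w is = weight G (i ∷ is)
  d s : ℚ
  d = natℚ (degree G i)
  s = sgn V i ^ r
  cancel : ∀ d s → d * s + - s * d ≡ 0ℚ
  cancel = solve 2 (λ d s → d :* s :+ (:- s) :* d := con 0ℚ) refl
  s*s≡1 : ∀ r → sgn V i ^ r * sgn V i ^ r ≡ 1ℚ
  s*s≡1 zero    = refl
  s*s≡1 (suc r) = trans (regroup (sgn V i) (sgn V i ^ r)) (cong₂ _*_ (sgn*sgn V i) (s*s≡1 r))
    where
    regroup : ∀ a b → a * b * (a * b) ≡ a * a * (b * b)
    regroup = solve 2 (λ a b → a :* b :* (a :* b) := a :* a :* (b :* b)) refl
  ∏≡-s : ∀ is → setOf (i ∷ is) ∈ₗ Hypergraph.edges G → ∏ᵗ (sgn V) is ≡ - s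
  ∏≡-s is adj = begin
    p              ≡⟨ ℚ.*-identityˡ p ⟨
    1ℚ * p         ≡⟨ cong (_* p) (s*s≡1 r) ⟨
    s * s * p      ≡⟨ ℚ.*-assoc s s p ⟩
    s * (s * p)    ≡⟨ cong (s *_) (trans (sgn-^-* V i is) (-1^odd (odd i is adj))) ⟩
    s * (- 1ℚ)     ≡⟨ times-1 s ⟩
    - s            ∎
    where
    p : ℚ
    p = ∏ᵗ (sgn V) is
    times-1 : ∀ s → s * (- 1ℚ) ≡ - s
    times-1 = solve 1 (λ s → s :* con (- 1ℚ) := :- s) refl
  term : ∀ is → w is * ∏ᵗ (sgn V) is ≡ - s * w is
  term is with setOf (i ∷ is) ∈ₗ? Hypergraph.edges G
  ... | yes adj = trans (cong (c * 1ℚ *_) (∏≡-s is adj)) (ℚ.*-comm (c * 1ℚ) (- s))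
    where
    c : ℚ
    c = (1ℤ / (r !)) {{r ℕ.!≢0}}
  ... | no  _   = vanish c (∏ᵗ (sgn V) is) s
    where
    c : ℚ
    c = (1ℤ / (r !)) {{r ℕ.!≢0}}
    vanish : ∀ c p s → c * 0ℚ * p ≡ - s * (c * 0ℚ)
    vanish = solve 3 (λ c p s → c :* con 0ℚ :* p := (:- s) :* (c :* con 0ℚ)) refl

-- The coordinates are constant sequences, so the residual is zero at every index and the threshold
-- `0` suffices.
oddBipartite⇒hEigenvalue : ∀ {r n} (G : Hypergraph (suc r) n) →
  2 ∣ suc r × OddBipartite G → IsHEigenvalue (signlessLaplacian G) 0ℝ
oddBipartite⇒hEigenvalue {r} {suc n} G (2∣k , _ , V , _ , odd) = x , x≉0 , λ i δ 0<δ → 0 , λ m _ →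
  subst (λ q → ∣ q ∣ < δ) (sym (residual i m)) 0<δ
  where
  x : Fin (suc n) → ℝ
  x j = fromℚ (sgn V j)
  x≉0 : ¬ (∀ i → x i ≈ 0ℝ)
  -- At tolerance 1, being close to zero would require a sign to have absolute value below 1.
  x≉0 x≈0 = let N , h = x≈0 zero 1ℚ (ℚ.positive⁻¹ 1ℚ) in
    ℚ.<-irrefl (trans (cong ∣_∣ (ℚ.+-identityʳ (sgn V zero))) (∣sgn∣≡1 V zero)) (h N ℕ.≤-refl)
  residual : ∀ i m → seq (apply (signlessLaplacian G) x i) m - 0ℚ * seq (x i ℝ.^ r) m ≡ 0ℚ
  residual i m = cong₂ _-_
    (trans (seq-apply G x i m) (oddSigns⇒kernel G V (oddTransversal⇒oddSigns G V 2∣k odd) i))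
    (ℚ.*-zeroˡ (seq (x i ℝ.^ r) m))
oddBipartite⇒hEigenvalue {n = zero} G _ = contradiction refl (ℕ.≢-nonZero⁻¹ 0 {{Hypergraph.vertices-nonempty G}})

theorem2p5 : (m n : ℕ) → let k = suc (suc m) in
    (G : Hypergraph k n) → Connected G → Hypergraph.edges G ≢ [] →
    (2 ∣ k × OddBipartite G) ⇔ IsHEigenvalue (signlessLaplacian G) 0ℝ
theorem2p5 m n G connected edges≢[] =
  mk⇔ (oddBipartite⇒hEigenvalue G) (hEigenvalue⇒oddBipartite G connected edges≢[])
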